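{- If there is an output-polynomial time (respectively, a polynomial-delay) algorithm for enumerating all minimal connected dominating sets of $2$-degenerate bipartite graphs, then there is an output-polynomial time (respectively, a polynomial-delay) algorithm for enumerating all minimal transversals of hypergraphs.
   Context: Graphs are finite, undirected and simple. A dominating set of $G$ is a set $D\subseteq V(G)$ such that every vertex in $V(G)\setminus D$ has a neighbor in $D$; it is connected if $G[D]$ is connected; a connected dominating set is minimal if no proper subset is a connected dominating set. A graph is $k$-degenerate if it has a vertex ordering $(v_1,\dots,v_n)$ such that each $v_i$ has at most $k$ neighbors in $G[\{v_i,\dots,v_n\}]$. A transversal of a hypergraph $\mathcal H=(V,\mathcal E)$ is a set $S\subseteq V$ such that each hyperedge $e\in\mathcal E$ contains at least one vertex of $S$; minimality is with respect to inclusion. Enumerating means outputting every such set exactly once. An enumeration algorithm runs in output-polynomial time if its total running time is bounded by a polynomial in the combined size of the input and all outputs; it runs in polynomial delay if the time elapsed between every two consecutive outputs (including pre-processing and post-processing) is bounded by a polynomial in the input size only. -}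

module Defs where

open import Data.Bool using (Bool; true; false; T; _∧_)
open import Data.Fin using (Fin)
open import Data.Fin.Permutation using (Permutation′; _⟨$⟩ʳ_)
open import Data.Fin.Properties using (_≤?_)
open import Data.Fin.Subset using (Subset; _∈_; _∉_; _⊂_; Nonempty; ∣_∣)
open import Data.List using (List; []; _∷_; _++_; [_]; map; foldr; replicate)
open import Data.List.Membership.Propositional using () renaming (_∈_ to _∈ˡ_)
open import Data.List.Relation.Unary.All using (All)
open import Data.List.Relation.Unary.Unique.Propositional using (Unique)
open import Data.Nat using (ℕ; zero; suc; _+_; _*_; _≤_)
open import Data.Nat.ListAction using (sum)
open import Data.Product using (Σ; ∃; ∃-syntax; _×_; _,_)
open import Data.Vec as Vec using (Vec; lookup; tabulate; _[_]≔_; toList)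
open import Function.Bundles using (_⇔_)
open import Relation.Binary.Construct.Closure.ReflexiveTransitive using (Star)
open import Relation.Binary.PropositionalEquality using (_≡_; _≢_)
open import Relation.Nullary using (¬_; does)

-- Model of computation: Jones's WHILE language over binary trees, extended
-- with an output instruction.  Trees are pointer structures: reading a
-- variable, `hd`, `tl` and `cons` are constant-time (values are shared, never
-- copied), and the only test is against `nil`.  Up to polynomial overhead, on
-- total time as well as on delay, this is equivalent to the logarithmic-cost
-- RAM (memory kept as a trie, addresses as lists of bits).

infixr 5 _·_

data Tree : Set where
  nil : Tree
  _·_ : Tree → Tree → Tree

size : Tree → ℕ
size nil     = 1
size (s · t) = suc (size s + size t)

data Expr (k : ℕ) : Set where
  var   : Fin k → Expr k
  nil   : Expr k
  cons  : Expr k → Expr k → Expr k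
  hd tl : Expr k → Expr k

infix  4 _≔_
infixr 3 _⨾_

data Cmd (k : ℕ) : Set where
  _≔_           : Fin k → Expr k → Cmd k
  _⨾_           : Cmd k → Cmd k → Cmd k
  if_then_else_ : Expr k → Cmd k → Cmd k → Cmd k
  while_loop_     : Expr k → Cmd k → Cmd k
  emit          : Expr k → Cmd k

Store : ℕ → Set
Store k = Vec Tree k

head tail : Tree → Tree
head nil     = nil
head (s · _) = s
tail nil     = nil
tail (_ · t) = t

⟦_⟧ : ∀ {k} → Expr k → Store k → Tree
⟦ var x ⟧    σ = lookup σ x
⟦ nil ⟧      σ = nil
⟦ cons e f ⟧ σ = ⟦ e ⟧ σ · ⟦ f ⟧ σ
⟦ hd e ⟧     σ = head (⟦ e ⟧ σ)
⟦ tl e ⟧     σ = tail (⟦ e ⟧ σ)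

data Event : Set where
  tick   : Event
  output : Tree → Event

Trace : Set
Trace = List Event

infix 2 ⟨_,_⟩⇓⟨_,_⟩

-- Each assignment and each test takes one tick; the expressions of a fixed
-- program have bounded size, so charging for every operator would change the
-- time by a constant factor only.  Writing a tree takes as many ticks as it
-- has nodes.
data ⟨_,_⟩⇓⟨_,_⟩ {k : ℕ} : Cmd k → Store k → Trace → Store k → Set where

  assign : ∀ {x e σ} →
    ⟨ x ≔ e , σ ⟩⇓⟨ [ tick ] , σ [ x ]≔ ⟦ e ⟧ σ ⟩

  seq : ∀ {c d σ σ′ σ″ t u} →
    ⟨ c , σ ⟩⇓⟨ t , σ′ ⟩ → ⟨ d , σ′ ⟩⇓⟨ u , σ″ ⟩ →
    ⟨ c ⨾ d , σ ⟩⇓⟨ t ++ u , σ″ ⟩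

  if-true : ∀ {e c d σ σ′ t} →
    ⟦ e ⟧ σ ≢ nil → ⟨ c , σ ⟩⇓⟨ t , σ′ ⟩ →
    ⟨ if e then c else d , σ ⟩⇓⟨ tick ∷ t , σ′ ⟩

  if-false : ∀ {e c d σ σ′ t} →
    ⟦ e ⟧ σ ≡ nil → ⟨ d , σ ⟩⇓⟨ t , σ′ ⟩ →
    ⟨ if e then c else d , σ ⟩⇓⟨ tick ∷ t , σ′ ⟩

  while-true : ∀ {e c σ σ′ σ″ t u} →
    ⟦ e ⟧ σ ≢ nil → ⟨ c , σ ⟩⇓⟨ t , σ′ ⟩ → ⟨ while e loop c , σ′ ⟩⇓⟨ u , σ″ ⟩ →
    ⟨ while e loop c , σ ⟩⇓⟨ tick ∷ t ++ u , σ″ ⟩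

  while-false : ∀ {e c σ} →
    ⟦ e ⟧ σ ≡ nil →
    ⟨ while e loop c , σ ⟩⇓⟨ [ tick ] , σ ⟩

  emit : ∀ {e σ} →
    ⟨ emit e , σ ⟩⇓⟨ replicate (size (⟦ e ⟧ σ)) tick ++ [ output (⟦ e ⟧ σ) ] , σ ⟩

-- The input is placed in variable zero, all other variables start as nil.
Program : Set
Program = ∃[ k ] Cmd (suc k)

initial : (k : ℕ) → Tree → Store (suc k)
initial k x = x Vec.∷ Vec.replicate k nil

-- The program halts on the given input, with the given trace.
Run : Program → Tree → Trace → Set
Run (k , c) x t = ∃[ σ ] ⟨ c , initial k x ⟩⇓⟨ t , σ ⟩

outputs : Trace → List Tree
outputs []             = []
outputs (tick     ∷ t) = outputs t
outputs (output d ∷ t) = d ∷ outputs t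

time : Trace → ℕ
time []             = 0
time (tick     ∷ t) = suc (time t)
time (output _ ∷ t) = time t

-- Time before the first output, between consecutive outputs, and after the
-- last output.
delays : Trace → List ℕ
delays = go 0
  module Delays where
  go : ℕ → Trace → List ℕ
  go n []             = n ∷ []
  go n (tick     ∷ t) = go (suc n) t
  go n (output _ ∷ t) = n ∷ go 0 t

-- Coefficients, constant term first.
Polynomial : Set
Polynomial = List ℕ

eval : Polynomial → ℕ → ℕ
eval p x = foldr (λ a r → a + x * r) 0 p

encodeBool : Bool → Tree
encodeBool false = nil
encodeBool true  = nil · nil

encodeList : ∀ {A : Set} → (A → Tree) → List A → Tree
encodeList f = foldr (λ a t → f a · t) nil

encodeℕ : ℕ → Tree
encodeℕ zero    = nil
encodeℕ (suc n) = nil · encodeℕ n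

encodeSubset : ∀ {n} → Subset n → Tree
encodeSubset X = encodeList encodeBool (toList X)

-- Problems asking for all subsets of a ground set with some property.
record EnumerationProblem : Set₁ where
  field
    Instance : Set
    encode   : Instance → Tree
    ground   : Instance → ℕ
    Solution : (I : Instance) → Subset (ground I) → Set

module _ (Π : EnumerationProblem) where
  open EnumerationProblem Π

  -- Every solution is output exactly once, and nothing else is output.
  Enumerates : Instance → List Tree → Set
  Enumerates I ds = Σ (List (Subset (ground I))) λ Xs →
    ds ≡ map encodeSubset Xs × Unique Xs × (∀ X → X ∈ˡ Xs ⇔ Solution I X)

  HasOutputPolynomialAlgorithm : Set
  HasOutputPolynomialAlgorithm =
    Σ Program λ P → Σ Polynomial λ p → ∀ I → ∃[ t ]
      Run P (encode I) t ×
      Enumerates I (outputs t) ×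
      time t ≤ eval p (size (encode I) + sum (map size (outputs t)))

  HasPolynomialDelayAlgorithm : Set
  HasPolynomialDelayAlgorithm =
    Σ Program λ P → Σ Polynomial λ p → ∀ I → ∃[ t ]
      Run P (encode I) t ×
      Enumerates I (outputs t) ×
      All (_≤ eval p (size (encode I))) (delays t)

record Graph : Set where
  field
    order       : ℕ
    adj         : Fin order → Fin order → Bool
    symmetric   : ∀ u v → adj u v ≡ adj v u
    irreflexive : ∀ v → adj v v ≡ false

  Vertex : Set
  Vertex = Fin order

  Adj : Vertex → Vertex → Set
  Adj u v = T (adj u v)

-- Adjacency matrix, row by row.
encodeGraph : Graph → Tree
encodeGraph G = encodeList encodeSubset (toList (tabulate λ u → tabulate (adj u)))
  where open Graph G

module _ (G : Graph) where
  open Graph G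

  Bipartite : Set
  Bipartite = Σ (Vertex → Bool) λ side → ∀ u v → Adj u v → side u ≢ side v

  -- In the ordering π, the neighbours of the i-th vertex among the i-th and
  -- later ones are counted through their positions.
  Degenerate : ℕ → Set
  Degenerate k = Σ (Permutation′ order) λ π → ∀ i →
    ∣ tabulate (λ j → does (i ≤? j) ∧ adj (π ⟨$⟩ʳ i) (π ⟨$⟩ʳ j)) ∣ ≤ k

  Dominating : Subset order → Set
  Dominating D = ∀ v → v ∉ D → ∃[ u ] u ∈ D × Adj v u

  InducedAdj : Subset order → Vertex → Vertex → Set
  InducedAdj D u v = u ∈ D × v ∈ D × Adj u v

  -- The graph without vertices is not regarded as connected.
  InducesConnected : Subset order → Set
  InducesConnected D =
    Nonempty D × (∀ u v → u ∈ D → v ∈ D → Star (InducedAdj D) u v)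

  ConnectedDominating : Subset order → Set
  ConnectedDominating D = Dominating D × InducesConnected D

Minimal : ∀ {n} → (Subset n → Set) → Subset n → Set
Minimal P X = P X × (∀ Y → Y ⊂ X → ¬ P Y)

record Hypergraph : Set where
  field
    order    : ℕ
    edges    : List (Subset order)
    distinct : Unique edges

-- The number of vertices in unary, followed by the incidence matrix.
encodeHypergraph : Hypergraph → Tree
encodeHypergraph H = encodeℕ order · encodeList encodeSubset edges
  where open Hypergraph H

Transversal : (H : Hypergraph) → Subset (Hypergraph.order H) → Set
Transversal H S = All (λ e → ∃[ v ] v ∈ e × v ∈ S) (Hypergraph.edges H)

MinimalTransversals : EnumerationProblem
MinimalTransversals = record
  { Instance = Hypergraph
  ; encode   = encodeHypergraph
  ; ground   = Hypergraph.order
  ; Solution = λ H → Minimal (Transversal H)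
  }

-- Membership in the class is a promise on the input: the algorithm is given
-- the graph only, neither the ordering nor the bipartition.
MinimalConnectedDominatingSets : (Graph → Set) → EnumerationProblem
MinimalConnectedDominatingSets 𝒞 = record
  { Instance = Σ Graph 𝒞
  ; encode   = λ (G , _) → encodeGraph G
  ; ground   = λ (G , _) → Graph.order G
  ; Solution = λ (G , _) → Minimal (ConnectedDominating G)
  }

TwoDegenerateBipartite : Graph → Set
TwoDegenerateBipartite G = Degenerate G 2 × Bipartite G

{-# OPTIONS --safe #-}
module Submission where

-- Let row zero be a new hyperedge containing all vertices of H.  Join each
-- vertex i of H to each row j with i ∈ j by a path through a vertex (j , i),
-- and attach two pendant vertices to every row and to every such subdivision
-- vertex, which forces both kinds into all connected dominating sets.  What
-- remains to be chosen are vertices of H: each of them connects its rows to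
-- row zero, so the set is connected exactly when every row is hit, and minimal
-- connected dominating sets correspond to minimal transversals.  Removing
-- pendants, then subdivision vertices, then the rest, shows 2-degeneracy.
--
-- The vertices of H come last in the adjacency matrix, hence a transversal is
-- recovered from an output by deleting a prefix of fixed length.

-- Joining hyperedges directly to their vertices can give large degeneracy. Subdividing these edges
-- caps it at two, at the price of new vertices that must be made inert, so they carry pendants as
-- well. Row zero does three things: it is a place outside every other row to which that row must be
-- connected, it is where all chosen vertices meet, and it dominates vertices lying in no hyperedge.
-- The second pendant settles the instance with no vertices and no hyperedges: with one pendant the
-- graph would be a single edge, and either end a minimal connected dominating set. Pairs with i ∉ j
-- get a cell too, so that the list of nodes depends only on the numbers of vertices and hyperedges.
--
-- A bijection between solutions does not by itself transfer running times: outputs must be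
-- rewritten without spoiling the delay, and a bound in terms of the target's outputs must become
-- one in terms of the source's. Both hold because the prefix, and every encoded dominating set,
-- have size polynomial in the instance.

open import Defs
open import Data.Bool using (Bool; true; false; _∧_; _∨_)
open import Data.Bool.Properties using (∨-comm; T-≡)
open import Data.Empty using (⊥; ⊥-elim)
open import Data.Fin using (Fin; zero; suc; toℕ; _≟_)
import Data.Fin as Fin
import Data.Fin.Permutation as Permutation
open import Data.Fin.Properties using (_≤?_; toℕ≤n; toℕ-injective)
open import Data.Fin.Subset using (Subset; _∈_; _∉_; _⊆_; _⊂_; _∪_; ⁅_⁆; ∣_∣)
open import Data.Fin.Subset.Properties
  using (_∈?_; p⊆q⇒∣p∣≤∣q∣; ∣⁅x⁆∣≡1; x∈⁅x⁆; x∈p∪q⁺; ⊆-antisym)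
open import Data.List
  using (List; []; _∷_; _++_; [_]; map; foldl; length; replicate; concatMap; reverse; _ʳ++_;
         applyUpTo; drop; allFin; cartesianProductWith)
import Data.List as List
open import Data.List.Membership.Propositional using () renaming (_∈_ to _∈ˡ_)
open import Data.List.Membership.Propositional.Properties
  using (∈-map⁺; ∈-map⁻; ∈-++⁺ˡ; ∈-++⁺ʳ; ∈-allFin; ∈-cartesianProductWith⁺;
         ∈-cartesianProductWith⁻; ∈-lookup)
open import Data.List.Properties
  using (++-assoc; ++-identityʳ; ++-ʳ++; reverse-involutive; map-++; map-∘; map-id; map-cong;
         map-cong-local; map-tabulate; map-replicate; length-map; length-drop; length-replicate)
open import Data.List.Relation.Unary.All using (All; []; _∷_)
import Data.List.Relation.Unary.All as All
import Data.List.Relation.Unary.All.Properties as All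
open import Data.List.Relation.Unary.AllPairs using (AllPairs; []; _∷_)
import Data.List.Relation.Unary.AllPairs as AllPairs
import Data.List.Relation.Unary.AllPairs.Properties as AllPairs
open import Data.List.Relation.Unary.Any using (here; there)
import Data.List.Relation.Unary.Any as Any
open import Data.List.Relation.Unary.Any.Properties using (lookup-index)
open import Data.List.Relation.Unary.Unique.Propositional using (Unique)
import Data.List.Relation.Unary.Unique.Propositional.Properties as Unique
open import Data.Nat using (ℕ; zero; suc; _+_; _*_; _∸_; _≤_; _<_; z≤n; s≤s; >-nonZero)
import Data.Nat as ℕ
open import Data.Nat.ListAction using (sum)
open import Data.Nat.Properties hiding (_≟_; _≤?_)
open import Data.Nat.Tactic.RingSolver using (solve-∀)
open import Data.Product using (∃-syntax; _×_; _,_; proj₁; proj₂)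
open import Data.Sum using (_⊎_; inj₁; inj₂; swap; [_,_]′)
open import Data.Unit using (⊤; tt)
open import Data.Vec as Vec using (Vec; []; _∷_; lookup; tabulate; toList)
open import Data.Vec.Properties
  using (lookup∘tabulate; tabulate∘lookup; tabulate-cong; lookup⇒[]=; []=⇒lookup;
         lookup-replicate; length-toList)
open import Function using (_∘_; id; const)
open import Function.Bundles using (_⇔_; mk⇔; Equivalence)
open import Relation.Binary.Construct.Closure.ReflexiveTransitive as Star using (Star; ε; _◅_; _◅◅_)
open import Relation.Binary.PropositionalEquality hiding ([_])
open import Relation.Nullary using (¬_; Dec; does; yes; no; contradiction)
open import Relation.Nullary.Decidable using (does-⇔)

open Equivalence using (to; from)

-- Polynomial-time functions on trees

infixl 6 _⊕_
infixl 7 _⊗_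
infixl 8 _⊚_

_⊕_ : Polynomial → Polynomial → Polynomial
[]      ⊕ q       = q
(a ∷ p) ⊕ []      = a ∷ p
(a ∷ p) ⊕ (b ∷ q) = a + b ∷ p ⊕ q

_⊗_ : Polynomial → Polynomial → Polynomial
[]      ⊗ q = []
(a ∷ p) ⊗ q = map (a *_) q ⊕ (0 ∷ p ⊗ q)

_⊚_ : Polynomial → Polynomial → Polynomial
[]      ⊚ q = []
(a ∷ p) ⊚ q = (a ∷ []) ⊕ q ⊗ (p ⊚ q)

eval-⊕ : ∀ p q x → eval (p ⊕ q) x ≡ eval p x + eval q x
eval-⊕ []      q       x = refl
eval-⊕ (a ∷ p) []      x = sym (+-identityʳ _)
eval-⊕ (a ∷ p) (b ∷ q) x rewrite eval-⊕ p q x = lemma a b x (eval p x) (eval q x)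
  where
  lemma : ∀ a b x r s → a + b + x * (r + s) ≡ a + x * r + (b + x * s)
  lemma = solve-∀

eval-map-* : ∀ a q x → eval (map (a *_) q) x ≡ a * eval q x
eval-map-* a []      x = sym (*-zeroʳ a)
eval-map-* a (b ∷ q) x rewrite eval-map-* a q x = lemma a b x (eval q x)
  where
  lemma : ∀ a b x r → a * b + x * (a * r) ≡ a * (b + x * r)
  lemma = solve-∀

eval-⊗ : ∀ p q x → eval (p ⊗ q) x ≡ eval p x * eval q x
eval-⊗ []      q x = refl
eval-⊗ (a ∷ p) q x
  rewrite eval-⊕ (map (a *_) q) (0 ∷ p ⊗ q) x | eval-map-* a q x | eval-⊗ p q x
  = lemma a x (eval p x) (eval q x)
  where
  lemma : ∀ a x r s → a * s + x * (r * s) ≡ (a + x * r) * s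
  lemma = solve-∀

eval-⊚ : ∀ p q x → eval (p ⊚ q) x ≡ eval p (eval q x)
eval-⊚ []      q x = refl
eval-⊚ (a ∷ p) q x
  rewrite eval-⊕ (a ∷ []) (q ⊗ (p ⊚ q)) x | eval-⊗ q (p ⊚ q) x | eval-⊚ p q x | *-zeroʳ x | +-identityʳ a
  = refl

-- Coefficients are natural numbers. Monotonicity is what allows a size bound to be substituted into
-- a time bound.
eval-mono : ∀ p {x y} → x ≤ y → eval p x ≤ eval p y
eval-mono []      x≤y = z≤n
eval-mono (a ∷ p) x≤y = +-monoʳ-≤ a (*-mono-≤ x≤y (eval-mono p x≤y))

-- The combinators below follow the arithmetic operations, so a bound written as an expression in
-- `n` carries its polynomial along and no coefficients are computed by hand.
PolyBounded : (ℕ → ℕ) → Set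
PolyBounded f = ∃[ p ] ∀ n → f n ≤ eval p n

constᵇ : ∀ a → PolyBounded (λ _ → a)
constᵇ a = a ∷ [] , λ n → m≤m+n a (n * 0)

idᵇ : PolyBounded (λ n → n)
idᵇ = 0 ∷ 1 ∷ [] , λ n → ≤-reflexive (lemma n)
  where
  lemma : ∀ n → n ≡ n * (1 + n * 0)
  lemma = solve-∀

infixl 6 _+ᵇ_
infixl 7 _*ᵇ_
infixr 8 _∘ᵇ_

_+ᵇ_ : ∀ {f g} → PolyBounded f → PolyBounded g → PolyBounded (λ n → f n + g n)
(p , f≤p) +ᵇ (q , g≤q) = p ⊕ q , λ n →
  ≤-trans (+-mono-≤ (f≤p n) (g≤q n)) (≤-reflexive (sym (eval-⊕ p q n)))

_*ᵇ_ : ∀ {f g} → PolyBounded f → PolyBounded g → PolyBounded (λ n → f n * g n)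
(p , f≤p) *ᵇ (q , g≤q) = p ⊗ q , λ n →
  ≤-trans (*-mono-≤ (f≤p n) (g≤q n)) (≤-reflexive (sym (eval-⊗ p q n)))

_∘ᵇ_ : ∀ p {f} → PolyBounded f → PolyBounded (λ n → eval p (f n))
p ∘ᵇ (q , f≤q) = p ⊚ q , λ n →
  ≤-trans (eval-mono p (f≤q n)) (≤-reflexive (sym (eval-⊚ p q n)))

Bounded : (Tree → ℕ) → Set
Bounded f = ∃[ p ] ∀ v → f v ≤ eval p (size v)

bounded : ∀ {f g} → PolyBounded g → (∀ v → f v ≤ g (size v)) → Bounded f
bounded (p , g≤p) f≤g = p , λ v → ≤-trans (f≤g v) (g≤p (size v))

-- Every tree is the list of the left children along its right spine.
list : List Tree → Tree
list []       = nil
list (x ∷ xs) = x · list xs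

elems : Tree → List Tree
elems nil     = []
elems (x · l) = x ∷ elems l

encodeList-list : ∀ {A : Set} (f : A → Tree) xs → encodeList f xs ≡ list (map f xs)
encodeList-list f []       = refl
encodeList-list f (x ∷ xs) = cong (f x ·_) (encodeList-list f xs)

1≤size : ∀ t → 1 ≤ size t
1≤size nil     = s≤s z≤n
1≤size (s · t) = s≤s z≤n

size-head : ∀ t → size (head t) ≤ size t
size-head nil     = ≤-refl
size-head (s · t) = ≤-trans (m≤m+n (size s) (size t)) (n≤1+n _)

size-tail : ∀ t → size (tail t) ≤ size t
size-tail nil     = ≤-refl
size-tail (s · t) = ≤-trans (m≤n+m (size t) (size s)) (n≤1+n _)

length-elems≤size : ∀ t → length (elems t) ≤ size t
length-elems≤size nil     = z≤n
length-elems≤size (s · t) = s≤s (≤-trans (length-elems≤size t) (m≤n+m _ (size s)))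

elems-small : ∀ {n} t → size t ≤ n → All (λ x → size x ≤ n) (elems t)
elems-small nil     _ = []
elems-small (s · t) h =
  ≤-trans (size-head (s · t)) h ∷ elems-small t (≤-trans (size-tail (s · t)) h)

replicate-+ : ∀ {A : Set} m n (x : A) → replicate (m + n) x ≡ replicate m x ++ replicate n x
replicate-+ zero    n x = refl
replicate-+ (suc m) n x = cong (x ∷_) (replicate-+ m n x)

-- A run without outputs is described by its number of ticks alone.
Steps : ∀ {k} → Cmd k → Store k → ℕ → Store k → Set
Steps c σ n σ′ = ⟨ c , σ ⟩⇓⟨ replicate n tick , σ′ ⟩

infixr 4 _▷_

_▷_ : ∀ {k m n} {c d : Cmd k} {σ σ′ σ″} →
  Steps c σ m σ′ → Steps d σ′ n σ″ → Steps (c ⨾ d) σ (m + n) σ″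
_▷_ {m = m} {n} {c} {d} p q =
  subst (λ t → ⟨ c ⨾ d , _ ⟩⇓⟨ t , _ ⟩) (sym (replicate-+ m n tick)) (seq p q)

iterate : ∀ {k m n e} {c : Cmd k} {σ σ′ σ″} → ⟦ e ⟧ σ ≢ nil →
  Steps c σ m σ′ → Steps (while e loop c) σ′ n σ″ → Steps (while e loop c) σ (1 + (m + n)) σ″
iterate {m = m} {n} {e} {c} e≢nil p q =
  subst (λ t → ⟨ while e loop c , _ ⟩⇓⟨ tick ∷ t , _ ⟩) (sym (replicate-+ m n tick))
    (while-true e≢nil p q)

pattern #0 = zero
pattern #1 = suc zero

-- A polynomial-time function, computed in place on variable 0.  Variable 1 is
-- a stack, given back unchanged; the remaining variables are not touched.
record PolyFun : Set where
  field
    fun        : Tree → Tree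
    cmd        : ∀ {k} → Cmd (2 + k)
    steps      : Tree → ℕ
    run        : ∀ {k} v s (ρ : Vec Tree k) →
                 Steps cmd (v ∷ s ∷ ρ) (steps v) (fun v ∷ s ∷ ρ)
    steps-poly : Bounded steps
    size-poly  : Bounded (size ∘ fun)

  stepsᵖ sizeᵖ : Polynomial
  stepsᵖ = proj₁ steps-poly
  sizeᵖ  = proj₁ size-poly

  steps≤ : ∀ {n} v → size v ≤ n → steps v ≤ eval stepsᵖ n
  steps≤ v h = ≤-trans (proj₂ steps-poly v) (eval-mono stepsᵖ h)

  size≤ : ∀ {n} v → size v ≤ n → size (fun v) ≤ eval sizeᵖ n
  size≤ v h = ≤-trans (proj₂ size-poly v) (eval-mono sizeᵖ h)

open PolyFun

idᶠ hdᶠ tlᶠ nilᶠ : PolyFun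
idᶠ = record
  { fun = id ; cmd = #0 ≔ var #0 ; steps = λ _ → 1 ; run = λ _ _ _ → assign
  ; steps-poly = bounded (constᵇ 1) (λ _ → ≤-refl)
  ; size-poly  = bounded idᵇ (λ _ → ≤-refl) }
hdᶠ = record
  { fun = head ; cmd = #0 ≔ hd (var #0) ; steps = λ _ → 1 ; run = λ _ _ _ → assign
  ; steps-poly = bounded (constᵇ 1) (λ _ → ≤-refl)
  ; size-poly  = bounded idᵇ size-head }
tlᶠ = record
  { fun = tail ; cmd = #0 ≔ tl (var #0) ; steps = λ _ → 1 ; run = λ _ _ _ → assign
  ; steps-poly = bounded (constᵇ 1) (λ _ → ≤-refl)
  ; size-poly  = bounded idᵇ size-tail }
nilᶠ = record
  { fun = const nil ; cmd = #0 ≔ nil ; steps = λ _ → 1 ; run = λ _ _ _ → assign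
  ; steps-poly = bounded (constᵇ 1) (λ _ → ≤-refl)
  ; size-poly  = bounded (constᵇ 1) (λ _ → ≤-refl) }

infixr 9 _∘ᶠ_

-- The size bound of `f` keeps the running time of `g` polynomial in the original argument; this is
-- why `PolyFun` records `size-poly` next to `steps-poly`.
_∘ᶠ_ : PolyFun → PolyFun → PolyFun
g ∘ᶠ f = record
  { fun        = fun g ∘ fun f
  ; cmd        = cmd f ⨾ cmd g
  ; steps      = λ v → steps f v + steps g (fun f v)
  ; run        = λ v s ρ → run f v s ρ ▷ run g (fun f v) s ρ
  ; steps-poly = bounded (stepsᵖ f ∘ᵇ idᵇ +ᵇ stepsᵖ g ∘ᵇ sizeᵖ f ∘ᵇ idᵇ)
                   (λ v → +-mono-≤ (steps≤ f v ≤-refl) (steps≤ g _ (size≤ f v ≤-refl)))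
  ; size-poly  = bounded (sizeᵖ g ∘ᵇ sizeᵖ f ∘ᵇ idᵇ) (λ v → size≤ g _ (size≤ f v ≤-refl))
  }

⟪_,_⟫ : PolyFun → PolyFun → PolyFun
⟪ f , g ⟫ = record
  { fun        = λ v → fun f v · fun g v
  -- The argument is pushed before `f` runs. Then the top entry becomes the pair of the first result
  -- and the argument, so `g` can start from the argument while the first result waits on the stack.
  ; cmd        = #1 ≔ cons (var #0) (var #1) ⨾ cmd f ⨾
                 #1 ≔ cons (cons (var #0) (hd (var #1))) (tl (var #1)) ⨾
                 #0 ≔ tl (hd (var #1)) ⨾ cmd g ⨾
                 #0 ≔ cons (hd (hd (var #1))) (var #0) ⨾ #1 ≔ tl (var #1)
  ; steps      = λ v → 1 + (steps f v + (1 + (1 + (steps g v + 2))))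
  ; run        = λ v s ρ →
      assign ▷ run f v _ ρ ▷ assign ▷ assign ▷ run g v _ ρ ▷ assign ▷ assign
  ; steps-poly = bounded
      (constᵇ 1 +ᵇ (stepsᵖ f ∘ᵇ idᵇ +ᵇ (constᵇ 1 +ᵇ (constᵇ 1 +ᵇ (stepsᵖ g ∘ᵇ idᵇ +ᵇ constᵇ 2)))))
      (λ v → +-monoʳ-≤ 1 (+-mono-≤ (steps≤ f v ≤-refl)
               (+-monoʳ-≤ 2 (+-monoˡ-≤ 2 (steps≤ g v ≤-refl)))))
  ; size-poly  = bounded (constᵇ 1 +ᵇ (sizeᵖ f ∘ᵇ idᵇ +ᵇ sizeᵖ g ∘ᵇ idᵇ))
      (λ v → s≤s (+-mono-≤ (size≤ f v ≤-refl) (size≤ g v ≤-refl)))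
  }

cond : Tree → Tree → Tree → Tree
cond nil     s t = t
cond (_ · _) s t = s

ifᶠ : PolyFun → PolyFun → PolyFun → PolyFun
ifᶠ f g h = record
  { fun        = λ v → cond (fun f v) (fun g v) (fun h v)
  ; cmd        = #1 ≔ cons (var #0) (var #1) ⨾ cmd f ⨾
                 #0 ≔ cons (var #0) (hd (var #1)) ⨾ #1 ≔ tl (var #1) ⨾ branch
  ; steps      = λ v → 1 + (steps f v + (1 + (1 + branchSteps v (fun f v))))
  ; run        = λ v s ρ → assign ▷ run f v _ ρ ▷ assign ▷ assign ▷ branchRun v (fun f v) s ρ
  ; steps-poly = bounded
      (constᵇ 1 +ᵇ (stepsᵖ f ∘ᵇ idᵇ +ᵇ (constᵇ 1 +ᵇ (constᵇ 1 +ᵇ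
        (constᵇ 2 +ᵇ (stepsᵖ g ∘ᵇ idᵇ +ᵇ stepsᵖ h ∘ᵇ idᵇ))))))
      (λ v → +-monoʳ-≤ 1 (+-mono-≤ (steps≤ f v ≤-refl) (+-monoʳ-≤ 2 (branchSteps≤ v (fun f v)))))
  ; size-poly  = bounded (sizeᵖ g ∘ᵇ idᵇ +ᵇ sizeᵖ h ∘ᵇ idᵇ) (λ v → cond≤ v (fun f v))
  }
  where
  branch : ∀ {k} → Cmd (2 + k)
  branch = if hd (var #0) then (#0 ≔ tl (var #0) ⨾ cmd g) else (#0 ≔ tl (var #0) ⨾ cmd h)

  branchSteps : Tree → Tree → ℕ
  branchSteps v nil     = 2 + steps h v
  branchSteps v (_ · _) = 2 + steps g v

  branchRun : ∀ {k} v b s (ρ : Vec Tree k) →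
    Steps branch ((b · v) ∷ s ∷ ρ) (branchSteps v b) (cond b (fun g v) (fun h v) ∷ s ∷ ρ)
  branchRun v nil     s ρ = if-false refl (assign ▷ run h v s ρ)
  branchRun v (_ · _) s ρ = if-true (λ ()) (assign ▷ run g v s ρ)

  branchSteps≤ : ∀ v b → branchSteps v b ≤
    2 + (eval (stepsᵖ g) (size v) + eval (stepsᵖ h) (size v))
  branchSteps≤ v nil     = +-monoʳ-≤ 2 (≤-trans (steps≤ h v ≤-refl) (m≤n+m _ _))
  branchSteps≤ v (_ · _) = +-monoʳ-≤ 2 (≤-trans (steps≤ g v ≤-refl) (m≤m+n _ _))

  cond≤ : ∀ v b → size (cond b (fun g v) (fun h v)) ≤
    eval (sizeᵖ g) (size v) + eval (sizeᵖ h) (size v)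
  cond≤ v nil     = ≤-trans (size≤ h v ≤-refl) (m≤n+m _ _)
  cond≤ v (_ · _) = ≤-trans (size≤ g v ≤-refl) (m≤m+n _ _)

-- The growth condition keeps the accumulator polynomially small; it may use
-- an invariant relating the initial accumulator to the current one.
module Fold
  (f : PolyFun)
  (I : Tree → Tree → Set) (I-refl : ∀ a → I a a)
  (κ : Polynomial)
  (grow : ∀ n a₀ a x → size a₀ ≤ n → size x ≤ n → I a₀ a →
          I a₀ (fun f (a · x)) × size (fun f (a · x)) ≤ size a + eval κ n)
  where

  loop : ∀ {k} → Cmd (2 + k)
  loop = while hd (var #1) loop
    (#0 ≔ cons (var #0) (hd (hd (var #1))) ⨾
     #1 ≔ cons (tl (hd (var #1))) (tl (var #1)) ⨾ cmd f)

  result : Tree → Tree → Tree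
  result a l = foldl (λ a x → fun f (a · x)) a (elems l)

  loopSteps : Tree → Tree → ℕ
  loopSteps a nil     = 1
  loopSteps a (x · l) = 1 + (1 + (1 + steps f (a · x)) + loopSteps (fun f (a · x)) l)

  loopRun : ∀ {k} a l s (ρ : Vec Tree k) →
    Steps loop (a ∷ (l · s) ∷ ρ) (loopSteps a l) (result a l ∷ (nil · s) ∷ ρ)
  loopRun a nil     s ρ = while-false refl
  loopRun a (x · l) s ρ =
    iterate (λ ()) (assign ▷ assign ▷ run f (a · x) (l · s) ρ) (loopRun (fun f (a · x)) l s ρ)

  module _ (n m : ℕ) (a₀ : Tree) (a₀≤n : size a₀ ≤ n) where

    -- Additive growth is essential: iterating an arbitrary polynomial size bound once per element
    -- could give exponential size. The bound `m` covers the accumulator together with all that the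
    -- remaining elements can still add, so it survives each iteration.
    result≤ : ∀ a l → All (λ x → size x ≤ n) (elems l) → I a₀ a →
      size a + length (elems l) * eval κ n ≤ m → size (result a l) ≤ m
    result≤ a nil     []         inv a≤m = ≤-trans (m≤m+n (size a) 0) a≤m
    result≤ a (x · l) (x≤ ∷ xs≤) inv a≤m with grow n a₀ a x a₀≤n x≤ inv
    ... | inv′ , le = result≤ _ l xs≤ inv′
      (≤-trans (+-monoˡ-≤ _ le) (≤-trans (≤-reflexive (+-assoc (size a) _ _)) a≤m))

    -- Each element costs a test, two assignments and one run of `f` on a pair of parts of sizes at
    -- most `m` and `n`; the extra 1 is the final failing test.
    loopSteps≤ : ∀ a l → All (λ x → size x ≤ n) (elems l) → I a₀ a →
      size a + length (elems l) * eval κ n ≤ m →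
      loopSteps a l ≤ 1 + length (elems l) * (3 + eval (stepsᵖ f) (1 + (m + n)))
    loopSteps≤ a nil     []         inv a≤m = s≤s z≤n
    loopSteps≤ a (x · l) (x≤ ∷ xs≤) inv a≤m with grow n a₀ a x a₀≤n x≤ inv
    ... | inv′ , le = s≤s (≤-trans
      (+-mono-≤ (+-monoʳ-≤ 2 (steps≤ f (a · x) (s≤s (+-mono-≤ (≤-trans (m≤m+n _ _) a≤m) x≤))))
                (loopSteps≤ _ l xs≤ inv′
                  (≤-trans (+-monoˡ-≤ _ le) (≤-trans (≤-reflexive (+-assoc (size a) _ _)) a≤m))))
      (≤-reflexive (lemma (eval (stepsᵖ f) (1 + (m + n)))
        (length (elems l) * (3 + eval (stepsᵖ f) (1 + (m + n)))))))
      where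
      lemma : ∀ x y → 2 + x + (1 + y) ≡ 3 + x + y
      lemma = solve-∀

  growth : ∀ v → size (head v) + length (elems (tail v)) * eval κ (size v) ≤
                 size v + size v * eval κ (size v)
  growth v = +-mono-≤ (size-head v)
    (*-monoˡ-≤ _ (≤-trans (length-elems≤size (tail v)) (size-tail v)))

  growthᵇ : PolyBounded (λ n → n + n * eval κ n)
  growthᵇ = idᵇ +ᵇ idᵇ *ᵇ κ ∘ᵇ idᵇ

  foldᶠ : PolyFun
  foldᶠ = record
    { fun        = λ v → result (head v) (tail v)
    ; cmd        = #1 ≔ cons (tl (var #0)) (var #1) ⨾ #0 ≔ hd (var #0) ⨾ loop ⨾ #1 ≔ tl (var #1)
    ; steps      = λ v → 1 + (1 + (loopSteps (head v) (tail v) + 1))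
    ; run        = λ v s ρ → assign ▷ assign ▷ loopRun (head v) (tail v) s ρ ▷ assign
    ; steps-poly = bounded
        (constᵇ 2 +ᵇ (constᵇ 1 +ᵇ idᵇ *ᵇ (constᵇ 3 +ᵇ stepsᵖ f ∘ᵇ (constᵇ 1 +ᵇ (growthᵇ +ᵇ idᵇ)))
          +ᵇ constᵇ 1))
        (λ v → +-monoʳ-≤ 2 (+-monoˡ-≤ 1 (≤-trans
          (loopSteps≤ (size v) _ (head v) (size-head v) (head v) (tail v)
            (elems-small (tail v) (size-tail v)) (I-refl _) (growth v))
          (+-monoʳ-≤ 1 (*-monoˡ-≤ _ (≤-trans (length-elems≤size (tail v)) (size-tail v)))))))
    ; size-poly  = bounded growthᵇ
        (λ v → result≤ (size v) _ (head v) (size-head v) (head v) (tail v)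
          (elems-small (tail v) (size-tail v)) (I-refl _) (growth v))
    }

-- List operations in polynomial time

size-head-tail : ∀ t → size (head t) + size (tail t) ≤ 1 + size t
size-head-tail nil     = ≤-refl
size-head-tail (s · t) = ≤-trans (n≤1+n _) (n≤1+n _)

revAppStep : PolyFun
revAppStep = ⟪ tlᶠ , hdᶠ ⟫

revAppStep-grow : ∀ n a₀ a x → size a₀ ≤ n → size x ≤ n → ⊤ →
  ⊤ × size (fun revAppStep (a · x)) ≤ size a + eval (proj₁ (constᵇ 1 +ᵇ idᵇ)) n
revAppStep-grow n a₀ a x _ x≤n _ = tt , (begin
  suc (size x + size a)
    ≡⟨ +-comm (suc (size x)) (size a) ⟩
  size a + suc (size x)
    ≤⟨ +-monoʳ-≤ (size a) (≤-trans (s≤s x≤n) (proj₂ (constᵇ 1 +ᵇ idᵇ) n)) ⟩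
  size a + eval (proj₁ (constᵇ 1 +ᵇ idᵇ)) n ∎)
  where open ≤-Reasoning

module RevApp = Fold revAppStep (λ _ _ → ⊤) (λ _ → tt) (proj₁ (constᵇ 1 +ᵇ idᵇ)) revAppStep-grow

revAppᶠ : PolyFun
revAppᶠ = RevApp.foldᶠ

revAppᶠ-correct : ∀ xs ys → fun revAppᶠ (list ys · list xs) ≡ list (xs ʳ++ ys)
revAppᶠ-correct []       ys = refl
revAppᶠ-correct (x ∷ xs) ys = revAppᶠ-correct xs (x ∷ ys)

-- Sharper than the bound obtained from the fold: being additive, it meets the growth condition when
-- `revAppᶠ` is itself used inside a fold.
size-revAppᶠ : ∀ a l → size (fun revAppᶠ (a · l)) ≤ size a + size l
size-revAppᶠ a nil     = m≤m+n _ 1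
size-revAppᶠ a (x · l) = ≤-trans (size-revAppᶠ (x · a) l) (≤-reflexive (lemma (size x) (size a) (size l)))
  where
  lemma : ∀ x a l → suc (x + a) + l ≡ a + suc (x + l)
  lemma = solve-∀

reverseᶠ : PolyFun
reverseᶠ = revAppᶠ ∘ᶠ ⟪ nilᶠ , idᶠ ⟫

reverseᶠ-correct : ∀ xs → fun reverseᶠ (list xs) ≡ list (reverse xs)
reverseᶠ-correct xs = revAppᶠ-correct xs []

-- The accumulator pairs the environment with the results collected so far, in reverse order. The
-- invariant that the environment never changes bounds the argument of `g` independently of the
-- growing results.
module FlatMap (g : PolyFun) where

  step : PolyFun
  step = ⟪ hdᶠ ∘ᶠ hdᶠ , revAppᶠ ∘ᶠ ⟪ tlᶠ ∘ᶠ hdᶠ , g ∘ᶠ ⟪ hdᶠ ∘ᶠ hdᶠ , tlᶠ ⟫ ⟫ ⟫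

  κᵇ : PolyBounded (λ n → 2 + eval (sizeᵖ g) (1 + (n + n)))
  κᵇ = constᵇ 2 +ᵇ sizeᵖ g ∘ᵇ (constᵇ 1 +ᵇ (idᵇ +ᵇ idᵇ))

  grow : ∀ n a₀ a x → size a₀ ≤ n → size x ≤ n → head a ≡ head a₀ →
    head a ≡ head a₀ × size (fun step (a · x)) ≤ size a + eval (proj₁ κᵇ) n
  grow n a₀ a x a₀≤n x≤n eq = eq , (begin
    suc (size (head a) + size (fun revAppᶠ (tail a · y)))
      ≤⟨ s≤s (+-monoʳ-≤ (size (head a)) (size-revAppᶠ (tail a) y)) ⟩
    suc (size (head a) + (size (tail a) + size y))
      ≡⟨ cong suc (+-assoc (size (head a)) _ _) ⟨
    suc (size (head a) + size (tail a) + size y)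
      ≤⟨ s≤s (+-mono-≤ (size-head-tail a) (size≤ g (head a · x)
           (s≤s (+-mono-≤ (≤-trans (≤-reflexive (cong size eq)) (≤-trans (size-head a₀) a₀≤n)) x≤n)))) ⟩
    2 + (size a + z)
      ≡⟨ lemma (size a) z ⟩
    size a + (2 + z)
      ≤⟨ +-monoʳ-≤ (size a) (proj₂ κᵇ n) ⟩
    size a + eval (proj₁ κᵇ) n ∎)
    where
    open ≤-Reasoning
    y = fun g (head a · x)
    z = eval (sizeᵖ g) (1 + (n + n))
    lemma : ∀ s z → 2 + (s + z) ≡ s + (2 + z)
    lemma = solve-∀

  open Fold step (λ a₀ a → head a ≡ head a₀) (λ _ → refl) (proj₁ κᵇ) grow public

-- The argument is e · l, where e is an environment handed to g with each
-- element of l.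
opaque
  flatMapᶠ : PolyFun → PolyFun
  flatMapᶠ g = reverseᶠ ∘ᶠ tlᶠ ∘ᶠ FlatMap.foldᶠ g ∘ᶠ ⟪ ⟪ hdᶠ , nilᶠ ⟫ , tlᶠ ⟫

  flatMapᶠ-correct : ∀ g {A : Set} e (enc : A → Tree) (h : A → List Tree) →
    (∀ x → fun g (e · enc x) ≡ list (h x)) →
    ∀ xs → fun (flatMapᶠ g) (e · list (map enc xs)) ≡ list (concatMap h xs)
  flatMapᶠ-correct g e enc h gh xs = begin
    fun reverseᶠ (tail (FlatMap.result g (e · nil) (list (map enc xs))))
      ≡⟨ cong (fun reverseᶠ ∘ tail) (go xs []) ⟩
    fun reverseᶠ (list (reverse (concatMap h xs)))
      ≡⟨ reverseᶠ-correct (reverse (concatMap h xs)) ⟩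
    list (reverse (reverse (concatMap h xs)))
      ≡⟨ cong list (reverse-involutive (concatMap h xs)) ⟩
    list (concatMap h xs) ∎
    where
    open ≡-Reasoning
    go : ∀ xs acc → FlatMap.result g (e · list acc) (list (map enc xs)) ≡ e · list (concatMap h xs ʳ++ acc)
    go []       acc = refl
    go (x ∷ xs) acc
      rewrite gh x | revAppᶠ-correct (h x) acc | go xs (h x ʳ++ acc)
      = cong (λ l → e · list l) (sym (++-ʳ++ (h x)))

mapᶠ : PolyFun → PolyFun
mapᶠ g = flatMapᶠ ⟪ g , nilᶠ ⟫

mapᶠ-correct : ∀ g {A : Set} e (enc : A → Tree) (h : A → Tree) →
  (∀ x → fun g (e · enc x) ≡ h x) →
  ∀ xs → fun (mapᶠ g) (e · list (map enc xs)) ≡ list (map h xs)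
mapᶠ-correct g e enc h gh xs =
  trans (flatMapᶠ-correct ⟪ g , nilᶠ ⟫ e enc ([_] ∘ h) (λ x → cong (_· nil) (gh x)) xs)
        (cong list (go xs))
  where
  go : ∀ xs → concatMap ([_] ∘ h) xs ≡ map h xs
  go []       = refl
  go (x ∷ xs) = cong (h x ∷_) (go xs)

-- The accumulator is the remaining suffix paired with the suffixes already collected, which is
-- itself a list. Pairing it with the next suffix therefore pushes the current one. The traversed
-- elements only count the iterations.
tailsStep : PolyFun
tailsStep = ⟪ tlᶠ ∘ᶠ hdᶠ ∘ᶠ hdᶠ , hdᶠ ⟫

tailsStep-grow : ∀ n a₀ a x → size a₀ ≤ n → size x ≤ n → size (head a) ≤ size (head a₀) →
  size (tail (head a)) ≤ size (head a₀) ×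
  size (fun tailsStep (a · x)) ≤ size a + eval (proj₁ (constᵇ 1 +ᵇ idᵇ)) n
tailsStep-grow n a₀ a x a₀≤n _ inv = rem≤ , (begin
  suc (size (tail (head a)) + size a)
    ≤⟨ s≤s (+-monoˡ-≤ (size a) (≤-trans rem≤ (≤-trans (size-head a₀) a₀≤n))) ⟩
  suc n + size a
    ≡⟨ +-comm (suc n) (size a) ⟩
  size a + suc n
    ≤⟨ +-monoʳ-≤ (size a) (proj₂ (constᵇ 1 +ᵇ idᵇ) n) ⟩
  size a + eval (proj₁ (constᵇ 1 +ᵇ idᵇ)) n ∎)
  where
  open ≤-Reasoning
  rem≤ : size (tail (head a)) ≤ size (head a₀)
  rem≤ = ≤-trans (size-tail (head a)) inv

module Tails = Fold tailsStep
  (λ a₀ a → size (head a) ≤ size (head a₀)) (λ _ → ≤-refl) (proj₁ (constᵇ 1 +ᵇ idᵇ)) tailsStep-grow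

suffixes : List Tree → List Tree
suffixes xs = applyUpTo (λ i → list (drop i xs)) (length xs)

opaque
  tailsᶠ : PolyFun
  tailsᶠ = reverseᶠ ∘ᶠ tlᶠ ∘ᶠ Tails.foldᶠ ∘ᶠ ⟪ ⟪ idᶠ , nilᶠ ⟫ , idᶠ ⟫

  tailsᶠ-correct : ∀ xs → fun tailsᶠ (list xs) ≡ list (suffixes xs)
  tailsᶠ-correct xs = begin
    fun reverseᶠ (tail (Tails.result (list xs · nil) (list xs)))
      ≡⟨ cong (fun reverseᶠ ∘ tail) (go xs []) ⟩
    fun reverseᶠ (list (reverse (suffixes xs)))
      ≡⟨ reverseᶠ-correct (reverse (suffixes xs)) ⟩
    list (reverse (reverse (suffixes xs)))
      ≡⟨ cong list (reverse-involutive (suffixes xs)) ⟩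
    list (suffixes xs) ∎
    where
    open ≡-Reasoning
    go : ∀ xs acc → Tails.result (list xs · list acc) (list xs) ≡ nil · list (suffixes xs ʳ++ acc)
    go []       acc = refl
    go (x ∷ xs) acc = go xs (list (x ∷ xs) ∷ acc)

module Drop = Fold (tlᶠ ∘ᶠ hdᶠ) (λ _ _ → ⊤) (λ _ → tt) []
  (λ n a₀ a x _ _ _ → tt , ≤-trans (size-tail a) (m≤m+n _ 0))

dropᶠ : PolyFun
dropᶠ = Drop.foldᶠ

drop-nil : ∀ ys → Drop.result nil (list ys) ≡ nil
drop-nil []       = refl
drop-nil (y ∷ ys) = drop-nil ys

trueᶠ : PolyFun
trueᶠ = ⟪ nilᶠ , nilᶠ ⟫

opaque
  -- Dropping from one list as many elements as the other has leaves nothing exactly when the first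
  -- is not longer; this is tested in both directions.
  sameLengthᶠ : PolyFun
  sameLengthᶠ = ifᶠ dropᶠ nilᶠ (ifᶠ (dropᶠ ∘ᶠ ⟪ tlᶠ , hdᶠ ⟫) nilᶠ trueᶠ)

  sameLengthᶠ-correct : ∀ xs ys →
    fun sameLengthᶠ (list xs · list ys) ≡ encodeBool (does (length xs ℕ.≟ length ys))
  sameLengthᶠ-correct []       []       = refl
  sameLengthᶠ-correct []       (y ∷ ys) rewrite drop-nil ys = refl
  sameLengthᶠ-correct (x ∷ xs) []       = refl
  sameLengthᶠ-correct (x ∷ xs) (y ∷ ys) = sameLengthᶠ-correct xs ys

cond-∧ : ∀ b c → cond (encodeBool b) (encodeBool c) nil ≡ encodeBool (b ∧ c)
cond-∧ true  c = refl
cond-∧ false c = refl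

cond-∨ : ∀ b c → cond (encodeBool b) (nil · nil) (encodeBool c) ≡ encodeBool (b ∨ c)
cond-∨ true  c = refl
cond-∨ false c = refl

-- Reductions between enumeration problems

strip : Tree → Tree → Tree
strip nil     d = d
strip (_ · c) d = strip c (tail d)

size-strip : ∀ c d → size (strip c d) ≤ size d
size-strip nil     d = ≤-refl
size-strip (_ · c) d = ≤-trans (size-strip c (tail d)) (size-tail d)

-- The second trace is the first one with g applied to the outputs, and with
-- every stretch of ticks prolonged by a factor of at most K.
data Slowed (K : ℕ) (g : Tree → Tree) : Trace → Trace → Set where
  []    : Slowed K g [] []
  ticks : ∀ m {n t t′} → n ≤ K * m → Slowed K g t t′ →
          Slowed K g (replicate m tick ++ t) (replicate n tick ++ t′)
  out   : ∀ {d t t′} → Slowed K g t t′ → Slowed K g (output d ∷ t) (output (g d) ∷ t′)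

slowed-++ : ∀ {K g t t′ u u′} → Slowed K g t t′ → Slowed K g u u′ → Slowed K g (t ++ u) (t′ ++ u′)
slowed-++ [] q = q
slowed-++ {K} {g} {u = u} {u′} (ticks m {n} {t} {t′} n≤ p) q =
  subst₂ (Slowed K g) (sym (++-assoc (replicate m tick) t u)) (sym (++-assoc (replicate n tick) t′ u′))
    (ticks m n≤ (slowed-++ p q))
slowed-++ (out p) q = out (slowed-++ p q)

outputs-ticks : ∀ m t → outputs (replicate m tick ++ t) ≡ outputs t
outputs-ticks zero    t = refl
outputs-ticks (suc m) t = outputs-ticks m t

time-ticks : ∀ m t → time (replicate m tick ++ t) ≡ m + time t
time-ticks zero    t = refl
time-ticks (suc m) t = cong suc (time-ticks m t)

delays-ticks : ∀ k m t → Delays.go k (replicate m tick ++ t) ≡ Delays.go (m + k) t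
delays-ticks k zero    t = refl
delays-ticks k (suc m) t = trans (delays-ticks (suc k) m t) (cong (λ n → Delays.go n t) (+-suc m k))

slowed-outputs : ∀ {K g t t′} → Slowed K g t t′ → outputs t′ ≡ map g (outputs t)
slowed-outputs [] = refl
slowed-outputs {g = g} (ticks m {n} {t} {t′} _ p) =
  trans (outputs-ticks n t′) (trans (slowed-outputs p) (cong (map g) (sym (outputs-ticks m t))))
slowed-outputs (out p) = cong (_ ∷_) (slowed-outputs p)

slowed-time : ∀ {K g t t′} → Slowed K g t t′ → time t′ ≤ K * time t
slowed-time [] = z≤n
slowed-time {K} (ticks m {n} {t} {t′} n≤ p) rewrite time-ticks n t′ | time-ticks m t | *-distribˡ-+ K m (time t) =
  +-mono-≤ n≤ (slowed-time p)
slowed-time (out p) = slowed-time p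

-- `k` and `k′` are the ticks already counted since the last output. The constant `c` absorbs the
-- time of the reduction, spent before the first output; after an output both counters restart at 0.
slowed-delays : ∀ {K g t t′ c b k k′} → Slowed K g t t′ → k′ ≤ c + K * k →
  All (_≤ b) (Delays.go k t) → All (_≤ c + K * b) (Delays.go k′ t′)
slowed-delays {K} {c = c} [] k′≤ (k≤ ∷ []) = ≤-trans k′≤ (+-monoʳ-≤ c (*-monoʳ-≤ K k≤)) ∷ []
slowed-delays {K} {c = c} {k = k} {k′} (ticks m {n} {t} {t′} n≤ p) k′≤ ds
  rewrite delays-ticks k m t | delays-ticks k′ n t′ =
  slowed-delays p (≤-trans (+-mono-≤ n≤ k′≤) (≤-reflexive (lemma K m c k))) ds
  where
  lemma : ∀ K m c k → K * m + (c + K * k) ≡ c + K * (m + k)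
  lemma = solve-∀
slowed-delays {K} {c = c} (out p) k′≤ (k≤ ∷ ds) =
  ≤-trans k′≤ (+-monoʳ-≤ c (*-monoʳ-≤ K k≤)) ∷ slowed-delays p z≤n ds

pattern #2 = suc (suc zero)
pattern #3 = suc (suc (suc zero))

weakenExpr : ∀ {k} → Expr k → Expr (3 + k)
weakenExpr (var x)    = var (suc (suc (suc x)))
weakenExpr nil        = nil
weakenExpr (cons e f) = cons (weakenExpr e) (weakenExpr f)
weakenExpr (hd e)     = hd (weakenExpr e)
weakenExpr (tl e)     = tl (weakenExpr e)

stripLoop : ∀ {k} → Cmd (3 + k)
stripLoop = while var #1 loop (#0 ≔ tl (var #0) ⨾ #1 ≔ tl (var #1))

-- Variable 2 holds the list whose length is the number of bits to be stripped
-- from the outputs.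
stripOutputs : ∀ {k} → Cmd k → Cmd (3 + k)
stripOutputs (x ≔ e)                = suc (suc (suc x)) ≔ weakenExpr e
stripOutputs (c ⨾ d)                = stripOutputs c ⨾ stripOutputs d
stripOutputs (if e then c else d)   = if weakenExpr e then stripOutputs c else stripOutputs d
stripOutputs (while e loop c)       = while weakenExpr e loop stripOutputs c
stripOutputs (emit e)               =
  #0 ≔ weakenExpr e ⨾ #1 ≔ var #2 ⨾ stripLoop ⨾ emit (var #0)

weakenExpr-correct : ∀ {k} e v s c (σ : Store k) → ⟦ weakenExpr e ⟧ (v ∷ s ∷ c ∷ σ) ≡ ⟦ e ⟧ σ
weakenExpr-correct (var x)    v s c σ = refl
weakenExpr-correct nil        v s c σ = refl
weakenExpr-correct (cons e f) v s c σ = cong₂ _·_ (weakenExpr-correct e v s c σ) (weakenExpr-correct f v s c σ)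
weakenExpr-correct (hd e)     v s c σ = cong head (weakenExpr-correct e v s c σ)
weakenExpr-correct (tl e)     v s c σ = cong tail (weakenExpr-correct e v s c σ)

stripSteps : Tree → ℕ
stripSteps nil     = 1
stripSteps (_ · c) = 3 + stripSteps c

stripSteps≤ : ∀ c → stripSteps c ≤ 1 + 3 * size c
stripSteps≤ nil     = s≤s z≤n
stripSteps≤ (s · c) = ≤-trans (+-monoʳ-≤ 3 (stripSteps≤ c))
  (≤-trans (m≤m+n _ (3 * size s)) (≤-reflexive (lemma (size s) (size c))))
  where
  lemma : ∀ s c → 3 + (1 + 3 * c) + 3 * s ≡ 1 + 3 * suc (s + c)
  lemma = solve-∀

stripLoop-run : ∀ {k} d c c₀ (σ : Store k) →
  Steps stripLoop (d ∷ c ∷ c₀ ∷ σ) (stripSteps c) (strip c d ∷ nil ∷ c₀ ∷ σ)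
stripLoop-run d nil     c₀ σ = while-false refl
stripLoop-run d (_ · c) c₀ σ = iterate (λ ()) (assign ▷ assign) (stripLoop-run (tail d) c c₀ σ)

-- Two assignments and the stripping loop take at most 3 + 3 * `size c` ticks, charged to the at
-- least one tick spent on the original output; the remaining 1 pays for writing the stripped
-- output, which is no larger than the original.
slowdown : Tree → ℕ
slowdown c = 4 + 3 * size c

tick-slowed : ∀ c {g} → Slowed (slowdown c) g [ tick ] [ tick ]
tick-slowed c = ticks 1 (s≤s z≤n) []

-- The counter `c` survives for the next output, whereas the two scratch variables keep whatever the
-- last stripping left there, hence the existentials.
stripOutputs-run : ∀ {k} {cmd : Cmd k} {σ σ′ t} c → ⟨ cmd , σ ⟩⇓⟨ t , σ′ ⟩ → ∀ v s →
  ∃[ t′ ] ∃[ v′ ] ∃[ s′ ]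
    ⟨ stripOutputs cmd , v ∷ s ∷ c ∷ σ ⟩⇓⟨ t′ , v′ ∷ s′ ∷ c ∷ σ′ ⟩ ×
    Slowed (slowdown c) (strip c) t t′
stripOutputs-run {cmd = x ≔ e} {σ} c assign v s =
  _ , v , s ,
  subst (λ d → ⟨ stripOutputs (x ≔ e) , v ∷ s ∷ c ∷ σ ⟩⇓⟨ [ tick ] , v ∷ s ∷ c ∷ (σ Vec.[ x ]≔ d) ⟩)
    (weakenExpr-correct e v s c σ) assign ,
  tick-slowed c
stripOutputs-run c (seq p q) v s with stripOutputs-run c p v s
... | _ , v′ , s′ , p′ , pt with stripOutputs-run c q v′ s′
... | _ , v″ , s″ , q′ , qt = _ , v″ , s″ , seq p′ q′ , slowed-++ pt qt
stripOutputs-run {σ = σ} c (if-true {e} e≢nil p) v s with stripOutputs-run c p v s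
... | _ , v′ , s′ , p′ , pt =
  _ , v′ , s′ , if-true (e≢nil ∘ trans (sym (weakenExpr-correct e v s c σ))) p′ , slowed-++ (tick-slowed c) pt
stripOutputs-run {σ = σ} c (if-false {e} e≡nil p) v s with stripOutputs-run c p v s
... | _ , v′ , s′ , p′ , pt =
  _ , v′ , s′ , if-false (trans (weakenExpr-correct e v s c σ) e≡nil) p′ , slowed-++ (tick-slowed c) pt
stripOutputs-run {σ = σ} c (while-true {e} e≢nil p q) v s with stripOutputs-run c p v s
... | _ , v′ , s′ , p′ , pt with stripOutputs-run c q v′ s′
... | _ , v″ , s″ , q′ , qt =
  _ , v″ , s″ , while-true (e≢nil ∘ trans (sym (weakenExpr-correct e v s c σ))) p′ q′ ,
  slowed-++ (tick-slowed c) (slowed-++ pt qt)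
stripOutputs-run {σ = σ} c (while-false {e} e≡nil) v s =
  _ , v , s , while-false (trans (weakenExpr-correct e v s c σ) e≡nil) , tick-slowed c
stripOutputs-run {cmd = emit e} {σ} c emit v s =
  _ , strip c d′ , nil ,
  seq assign (seq assign (seq (stripLoop-run d′ c c σ) emit)) , slow
  where
  d  = ⟦ e ⟧ σ
  d′ = ⟦ weakenExpr e ⟧ (v ∷ s ∷ c ∷ σ)
  n  = 2 + (stripSteps c + size (strip c d))

  n≤ : n ≤ slowdown c * size d
  n≤ = begin
    2 + (stripSteps c + size (strip c d)) ≤⟨ +-monoʳ-≤ 2 (+-mono-≤ (stripSteps≤ c) (size-strip c d)) ⟩
    3 + 3 * size c + size d               ≤⟨ +-monoˡ-≤ (size d) (m≤m*n (3 + 3 * size c) (size d) {{>-nonZero (1≤size d)}}) ⟩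
    (3 + 3 * size c) * size d + size d    ≡⟨ +-comm _ (size d) ⟩
    slowdown c * size d                   ∎
    where open ≤-Reasoning

  slow : Slowed (slowdown c) (strip c) (replicate (size d) tick ++ [ output d ])
    ([ tick ] ++ ([ tick ] ++ (replicate (stripSteps c) tick ++
      (replicate (size (strip c d′)) tick ++ [ output (strip c d′) ]))))
  slow rewrite weakenExpr-correct e v s c σ =
    subst (λ u → Slowed (slowdown c) (strip c) (replicate (size d) tick ++ [ output d ]) (tick ∷ tick ∷ u))
      (trans (cong (_++ [ output (strip c d) ]) (replicate-+ (stripSteps c) (size (strip c d)) tick))
             (++-assoc (replicate (stripSteps c) tick) _ _))
      (ticks (size d) n≤ (out []))

-- Transfer of algorithms along a reduction

module _ (red : PolyFun) where

  -- After the shift by three, variable 3 is the input variable of the old program. The reduction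
  -- leaves the prefix and the new instance paired in variable 0; the prefix becomes the counter in
  -- variable 2.
  reduceProgram : Program → Program
  reduceProgram (k , c) = 3 + k ,
    (cmd red ⨾ #2 ≔ hd (var #0) ⨾ #3 ≔ tl (var #0) ⨾ stripOutputs c)

  reduceProgram-run : ∀ P x t → Run P (tail (fun red x)) t →
    let c = head (fun red x) in
    ∃[ t′ ] Run (reduceProgram P) x (replicate (steps red x + 2) tick ++ t′) ×
            Slowed (slowdown c) (strip c) t t′
  reduceProgram-run (k , c) x t (σ , p) with stripOutputs-run (head (fun red x)) p (fun red x) nil
  ... | t′ , v , s , p′ , slow = t′ ,
    (_ , subst (λ u → ⟨ _ , _ ⟩⇓⟨ u , _ ⟩) eq
      (seq (run red x nil _) (seq assign (seq assign p′)))) , slow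
    where
    eq : replicate (steps red x) tick ++ (tick ∷ tick ∷ t′) ≡ replicate (steps red x + 2) tick ++ t′
    eq = sym (trans (cong (_++ t′) (replicate-+ (steps red x) 2 tick)) (++-assoc (replicate (steps red x) tick) _ _))

-- Both sums are compared with the length of `xs`: each term on the left is at most `c`, each on the
-- right at least 1.
sum-map-≤ : ∀ {A B : Set} (f : A → ℕ) (g : B → ℕ) (h : A → B) c xs →
  (∀ x → f x ≤ c) → (∀ y → 1 ≤ g y) → sum (map f xs) ≤ c * sum (map g (map h xs))
sum-map-≤ f g h c []       f≤c 1≤g = z≤n
sum-map-≤ f g h c (x ∷ xs) f≤c 1≤g =
  ≤-trans (+-mono-≤ (≤-trans (f≤c x) (m≤m*n c (g (h x)) {{>-nonZero (1≤g (h x))}}))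
                    (sum-map-≤ f g h c xs f≤c 1≤g))
          (≤-reflexive (sym (*-distribˡ-+ c (g (h x)) _)))

-- A polynomial-time reduction that puts the solutions in bijection, those of
-- the source being obtained by deleting a prefix of those of the target.
record Reduction (Π Π′ : EnumerationProblem) : Set where
  open EnumerationProblem
  field
    red         : PolyFun
    translate   : Instance Π → Instance Π′
    prefix      : Instance Π → Tree
    red-correct : ∀ I → fun red (encode Π I) ≡ prefix I · encode Π′ (translate I)
    embed       : ∀ I → Subset (ground Π I) → Subset (ground Π′ (translate I))
    extract     : ∀ I → Subset (ground Π′ (translate I)) → Subset (ground Π I)
    strip-extract : ∀ I X → strip (prefix I) (encodeSubset X) ≡ encodeSubset (extract I X)
    extract-embed : ∀ I X → extract I (embed I X) ≡ X
    embed-extract : ∀ I X → Solution Π′ (translate I) X → embed I (extract I X) ≡ X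
    embed-solution   : ∀ I X → Solution Π I X → Solution Π′ (translate I) (embed I X)
    extract-solution : ∀ I X → Solution Π′ (translate I) X → Solution Π I (extract I X)
    outputᵖ     : Polynomial
    output≤     : ∀ I (X : Subset (ground Π′ I)) → size (encodeSubset X) ≤ eval outputᵖ (size (encode Π′ I))

module _ {Π Π′ : EnumerationProblem} (R : Reduction Π Π′) where
  open EnumerationProblem
  open Reduction R

  private
    b : ℕ → ℕ
    b n = eval (sizeᵖ red) n

    T : ℕ → ℕ
    T n = eval (stepsᵖ red) n + 2

    bᵇ : PolyBounded b
    bᵇ = sizeᵖ red ∘ᵇ idᵇ

    Tᵇ : PolyBounded T
    Tᵇ = stepsᵖ red ∘ᵇ idᵇ +ᵇ constᵇ 2

    size-red : ∀ I → size (fun red (encode Π I)) ≤ b (size (encode Π I))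
    size-red I = size≤ red (encode Π I) ≤-refl

    size-prefix : ∀ I → size (prefix I) ≤ b (size (encode Π I))
    size-prefix I = ≤-trans
      (subst (λ v → size (prefix I) ≤ size v) (sym (red-correct I)) (≤-trans (m≤m+n _ _) (n≤1+n _)))
      (size-red I)

    size-translate : ∀ I → size (encode Π′ (translate I)) ≤ b (size (encode Π I))
    size-translate I = ≤-trans
      (subst (λ v → size (encode Π′ (translate I)) ≤ size v) (sym (red-correct I)) (≤-trans (m≤n+m _ (size (prefix I))) (n≤1+n _)))
      (size-red I)

    slowdown≤ : ∀ I → slowdown (prefix I) ≤ 4 + 3 * b (size (encode Π I))
    slowdown≤ I = +-monoʳ-≤ 4 (*-monoʳ-≤ 3 (size-prefix I))

    reduced : ∀ P I {t} → Run P (encode Π′ (translate I)) t →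
      ∃[ t′ ] Run (reduceProgram red P) (encode Π I) (replicate (steps red (encode Π I) + 2) tick ++ t′) ×
              Slowed (slowdown (prefix I)) (strip (prefix I)) t t′
    reduced P I {t} p with reduceProgram-run red P (encode Π I) t
      (subst (λ v → Run P (tail v) t) (sym (red-correct I)) p)
    ... | t′ , p′ , s = t′ , p′ , subst (λ v → Slowed (slowdown (head v)) (strip (head v)) t t′) (red-correct I) s

    map-strip : ∀ I Xs → map (strip (prefix I)) (map encodeSubset Xs) ≡ map encodeSubset (map (extract I) Xs)
    map-strip I []       = refl
    map-strip I (X ∷ Xs) = cong₂ _∷_ (strip-extract I X) (map-strip I Xs)

    enumerates : ∀ I {ds} → Enumerates Π′ (translate I) ds → Enumerates Π I (map (strip (prefix I)) ds)
    enumerates I (Xs , refl , unique , sound) =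
      map (extract I) Xs , map-strip I Xs ,
      -- Distinct subsets may have equal extracts in general, but on the listed solutions `embed`
      -- undoes `extract`, so distinctness carries over.
      AllPairs.map (_∘ cong (embed I)) (AllPairs.map⁻ (subst Unique (sym (back Xs (λ X → to (sound X)))) unique)) ,
      λ X → mk⇔ (forth X) (λ sol →
        subst (_∈ˡ map (extract I) Xs) (extract-embed I X)
          (∈-map⁺ (extract I) (from (sound (embed I X)) (embed-solution I X sol))))
      where
      open Equivalence using (to; from)
      back : ∀ Ys → (∀ X → X ∈ˡ Ys → Solution Π′ (translate I) X) → map (embed I) (map (extract I) Ys) ≡ Ys
      back Ys sol = trans (sym (map-∘ Ys))
        (trans (map-cong-local (All.tabulate (λ {X} X∈ → embed-extract I X (sol X X∈)))) (map-id Ys))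
      forth : ∀ X → X ∈ˡ map (extract I) Xs → Solution Π I X
      forth X X∈ with ∈-map⁻ (extract I) X∈
      ... | Y , Y∈ , refl = extract-solution I Y (to (sound Y) Y∈)

    enumerates′ : ∀ I {t t′} n → Slowed (slowdown (prefix I)) (strip (prefix I)) t t′ →
      Enumerates Π′ (translate I) (outputs t) → Enumerates Π I (outputs (replicate n tick ++ t′))
    enumerates′ I {t′ = t′} n s en =
      subst (Enumerates Π I) (sym (trans (outputs-ticks n t′) (slowed-outputs s))) (enumerates I en)

    -- The target algorithm is timed against its own, longer outputs. There are as many of them as
    -- stripped outputs, and each is polynomially small in the instance.
    size-outputs : ∀ I {t t′} n → Slowed (slowdown (prefix I)) (strip (prefix I)) t t′ →
      Enumerates Π′ (translate I) (outputs t) →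
      sum (map size (outputs t)) ≤
        eval outputᵖ (b (size (encode Π I))) * sum (map size (outputs (replicate n tick ++ t′)))
    size-outputs I {t} {t′} n s (Xs , eq , _)
      rewrite outputs-ticks n t′ | slowed-outputs s | eq | sym (map-∘ {g = size} {f = encodeSubset} Xs)
            | sym (map-∘ {g = strip (prefix I)} {f = encodeSubset} Xs) =
      sum-map-≤ (size ∘ encodeSubset) size (strip (prefix I) ∘ encodeSubset) _ Xs
        (λ X → ≤-trans (output≤ (translate I) X) (eval-mono outputᵖ (size-translate I))) 1≤size

  polynomialDelay : HasPolynomialDelayAlgorithm Π′ → HasPolynomialDelayAlgorithm Π
  polynomialDelay (P , p , alg) = reduceProgram red P , proj₁ boundᵇ , correct
    where
    bound : ℕ → ℕ
    bound n = T n + (4 + 3 * b n) * eval p (b n)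

    boundᵇ : PolyBounded bound
    boundᵇ = Tᵇ +ᵇ (constᵇ 4 +ᵇ constᵇ 3 *ᵇ bᵇ) *ᵇ p ∘ᵇ bᵇ

    correct : ∀ I → ∃[ t ] Run (reduceProgram red P) (encode Π I) t ×
      Enumerates Π I (outputs t) × All (_≤ eval (proj₁ boundᵇ) (size (encode Π I))) (delays t)
    correct I with alg (translate I)
    ... | t , p-run , en , ds with reduced P I p-run
    ... | t′ , p′ , s = _ , p′ , enumerates′ I (steps red (encode Π I) + 2) s en ,
      subst (All _) (sym (delays-ticks 0 (steps red x + 2) t′))
        (All.map (λ d≤ → ≤-trans d≤ (≤-trans le (proj₂ boundᵇ (size x))))
          (slowed-delays s k≤ ds))
      where
      x = encode Π I
      K = slowdown (prefix I)
      k≤ : steps red x + 2 + 0 ≤ steps red x + 2 + K * 0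
      k≤ = +-monoʳ-≤ (steps red x + 2) z≤n
      le : steps red x + 2 + K * eval p (size (encode Π′ (translate I))) ≤ bound (size x)
      le = +-mono-≤ (+-monoˡ-≤ 2 (steps≤ red x ≤-refl))
             (*-mono-≤ (slowdown≤ I) (eval-mono p (size-translate I)))

  outputPolynomial : HasOutputPolynomialAlgorithm Π′ → HasOutputPolynomialAlgorithm Π
  outputPolynomial (P , p , alg) = reduceProgram red P , proj₁ boundᵇ , correct
    where
    bound : ℕ → ℕ
    bound n = T n + (4 + 3 * b n) * eval p (b n + eval outputᵖ (b n) * n)

    boundᵇ : PolyBounded bound
    boundᵇ = Tᵇ +ᵇ (constᵇ 4 +ᵇ constᵇ 3 *ᵇ bᵇ) *ᵇ p ∘ᵇ (bᵇ +ᵇ outputᵖ ∘ᵇ bᵇ *ᵇ idᵇ)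

    correct : ∀ I → ∃[ t ] Run (reduceProgram red P) (encode Π I) t ×
      Enumerates Π I (outputs t) ×
      time t ≤ eval (proj₁ boundᵇ) (size (encode Π I) + sum (map size (outputs t)))
    correct I with alg (translate I)
    ... | t , p-run , en , t≤ with reduced P I p-run
    ... | t′ , p′ , s = _ , p′ , enumerates′ I (steps red (encode Π I) + 2) s en ,
      ≤-trans (≤-reflexive (time-ticks (steps red x + 2) t′))
        (≤-trans (+-monoʳ-≤ (steps red x + 2) (≤-trans (slowed-time s) (*-monoʳ-≤ K t≤)))
          (≤-trans le (proj₂ boundᵇ n)))
      where
      x = encode Π I
      K = slowdown (prefix I)
      o = sum (map size (outputs (replicate (steps red x + 2) tick ++ t′)))
      n = size x + o
      x≤n : size x ≤ n
      x≤n = m≤m+n (size x) o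
      b-mono : b (size x) ≤ b n
      b-mono = eval-mono (sizeᵖ red) x≤n
      le : steps red x + 2 + K * eval p (size (encode Π′ (translate I)) + sum (map size (outputs t))) ≤ bound n
      le = +-mono-≤ (+-monoˡ-≤ 2 (steps≤ red x x≤n))
             (*-mono-≤ (≤-trans (slowdown≤ I) (+-monoʳ-≤ 4 (*-monoʳ-≤ 3 b-mono)))
               (eval-mono p (+-mono-≤ (≤-trans (size-translate I) b-mono)
                 (≤-trans (size-outputs I (steps red x + 2) s en)
                   (*-mono-≤ (eval-mono outputᵖ b-mono) (m≤n+m o (size x)))))))

-- The graph of an incidence relation

∣p∪q∣≤∣p∣+∣q∣ : ∀ {n} (p q : Subset n) → ∣ p ∪ q ∣ ≤ ∣ p ∣ + ∣ q ∣
∣p∪q∣≤∣p∣+∣q∣ []          []          = z≤n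
∣p∪q∣≤∣p∣+∣q∣ (false ∷ p) (false ∷ q) = ∣p∪q∣≤∣p∣+∣q∣ p q
∣p∪q∣≤∣p∣+∣q∣ (false ∷ p) (true ∷ q)  =
  ≤-trans (s≤s (∣p∪q∣≤∣p∣+∣q∣ p q)) (≤-reflexive (sym (+-suc ∣ p ∣ ∣ q ∣)))
∣p∪q∣≤∣p∣+∣q∣ (true ∷ p)  (false ∷ q) = s≤s (∣p∪q∣≤∣p∣+∣q∣ p q)
∣p∪q∣≤∣p∣+∣q∣ (true ∷ p)  (true ∷ q)  =
  s≤s (≤-trans (∣p∪q∣≤∣p∣+∣q∣ p q) (+-monoʳ-≤ ∣ p ∣ (n≤1+n ∣ q ∣)))

∈-tabulate⁺ : ∀ {n} (f : Fin n → Bool) {i} → f i ≡ true → i ∈ tabulate f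
∈-tabulate⁺ f {i} fi = lookup⇒[]= i (tabulate f) (trans (lookup∘tabulate f i) fi)

∈-tabulate⁻ : ∀ {n} (f : Fin n → Bool) {i} → i ∈ tabulate f → f i ≡ true
∈-tabulate⁻ f {i} i∈ = trans (sym (lookup∘tabulate f i)) ([]=⇒lookup i∈)

at-most-two : ∀ {n} (f : Fin n → Bool) p q → (∀ j → f j ≡ true → j ≡ p ⊎ j ≡ q) → ∣ tabulate f ∣ ≤ 2
at-most-two f p q h = begin
  ∣ tabulate f ∣            ≤⟨ p⊆q⇒∣p∣≤∣q∣ sub ⟩
  ∣ ⁅ p ⁆ ∪ ⁅ q ⁆ ∣         ≤⟨ ∣p∪q∣≤∣p∣+∣q∣ ⁅ p ⁆ ⁅ q ⁆ ⟩
  ∣ ⁅ p ⁆ ∣ + ∣ ⁅ q ⁆ ∣     ≡⟨ cong₂ _+_ (∣⁅x⁆∣≡1 p) (∣⁅x⁆∣≡1 q) ⟩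
  2 ∎
  where
  open ≤-Reasoning
  sub : tabulate f ⊆ ⁅ p ⁆ ∪ ⁅ q ⁆
  sub {j} j∈ with h j (∈-tabulate⁻ f j∈)
  ... | inj₁ refl = x∈p∪q⁺ (inj₁ (x∈⁅x⁆ p))
  ... | inj₂ refl = x∈p∪q⁺ (inj₂ (x∈⁅x⁆ q))

lookup-pairs : ∀ {A : Set} {R : A → A → Set} {xs} → AllPairs R xs →
  ∀ {i j} → i Fin.< j → R (List.lookup xs i) (List.lookup xs j)
lookup-pairs {xs = x ∷ xs} (px ∷ pxs) {zero}  {suc j} _         = All.lookup px (∈-lookup j)
lookup-pairs {xs = x ∷ xs} (px ∷ pxs) {suc i} {suc j} (s≤s i<j) = lookup-pairs pxs i<j

lookup-unique : ∀ {A : Set} {xs : List A} → Unique xs →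
  ∀ {i j} → List.lookup xs i ≡ List.lookup xs j → i ≡ j
lookup-unique {xs = x ∷ xs} (px ∷ pxs) {zero}  {zero}  eq = refl
lookup-unique {xs = x ∷ xs} (px ∷ pxs) {zero}  {suc j} eq = ⊥-elim (All.lookup px (∈-lookup j) eq)
lookup-unique {xs = x ∷ xs} (px ∷ pxs) {suc i} {zero}  eq = ⊥-elim (All.lookup px (∈-lookup i) (sym eq))
lookup-unique {xs = x ∷ xs} (px ∷ pxs) {suc i} {suc j} eq = cong suc (lookup-unique pxs eq)

does-true : ∀ {A : Set} {a? : Dec A} → does a? ≡ true → A
does-true {a? = yes a} _ = a

true-does : ∀ {A : Set} (a? : Dec A) → A → does a? ≡ true
true-does (yes _) _ = refl
true-does (no ¬a) a = contradiction a ¬a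

∧-true : ∀ {a b} → a ∧ b ≡ true → a ≡ true × b ≡ true
∧-true {true} {true} _ = refl , refl

data Tag : Set where
  pendant : Bool → Tag
  centre  : Tag

-- Row zero of the incidence relation is an additional hyperedge consisting of
-- all vertices, around which the connected dominating sets are built.
module Incidence (n m : ℕ) (bit : Fin (suc m) → Fin n → Bool) (bit-zero : ∀ i → bit zero i ≡ true) where

  -- (j , zero) stands for the j-th hyperedge, and (j , suc i) subdivides the
  -- edge joining it to the i-th vertex, or hangs from it when i ∉ j.
  Cell : Set
  Cell = Fin (suc m) × Fin (suc n)

  data Node : Set where
    cell : Tag → Cell → Node
    vert : Fin n → Node

  pattern pend b f = cell (pendant b) f
  pattern core f   = cell centre f
  pattern hub j    = j , zero
  pattern spoke j i = j , suc i

  same : Cell → Cell → Bool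
  same (j , c) (j′ , c′) = does (j ≟ j′) ∧ does (c ≟ c′)

  -- Every edge appears in one orientation only, the one along which `rank` increases. No node has
  -- more than two outgoing arcs, and this is the source of 2-degeneracy.
  arc : Node → Node → Bool
  arc (pend _ f)           (core f′)       = same f f′
  arc (core (spoke j i))   (core (hub j′)) = does (j ≟ j′)
  arc (core (spoke j i))   (vert i′)       = bit j i ∧ does (i ≟ i′)
  arc _                    _               = false

  data Arc : Node → Node → Set where
    pend-core : ∀ {b f} → Arc (pend b f) (core f)
    spoke-hub : ∀ {j i} → Arc (core (spoke j i)) (core (hub j))
    spoke-vert : ∀ {j i} → bit j i ≡ true → Arc (core (spoke j i)) (vert i)

  arc⁻ : ∀ u v → arc u v ≡ true → Arc u v
  arc⁻ (pend b f) (core f′) eq with ∧-true {does (proj₁ f ≟ proj₁ f′)} eq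
  ... | p , q with does-true {a? = proj₁ f ≟ proj₁ f′} p | does-true {a? = proj₂ f ≟ proj₂ f′} q
  ... | refl | refl = pend-core
  arc⁻ (core (spoke j i)) (core (hub j′)) eq with does-true {a? = j ≟ j′} eq
  ... | refl = spoke-hub
  arc⁻ (core (spoke j i)) (vert i′) eq with ∧-true {bit j i} eq
  ... | p , q with does-true {a? = i ≟ i′} q
  ... | refl = spoke-vert p

  arc⁺ : ∀ {u v} → Arc u v → arc u v ≡ true
  arc⁺ (pend-core {f = j , c})
    rewrite true-does (j ≟ j) refl | true-does (c ≟ c) refl = refl
  arc⁺ (spoke-hub {j}) = true-does (j ≟ j) refl
  arc⁺ (spoke-vert {i = i} b) rewrite b = true-does (i ≟ i) refl

  link : Node → Node → Bool
  link u v = arc u v ∨ arc v u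

  Link : Node → Node → Set
  Link u v = Arc u v ⊎ Arc v u

  link⁻ : ∀ u v → link u v ≡ true → Link u v
  link⁻ u v eq with arc u v in uv
  ... | true  = inj₁ (arc⁻ u v uv)
  ... | false = inj₂ (arc⁻ v u eq)

  link⁺ : ∀ u v → Link u v → link u v ≡ true
  link⁺ u v (inj₁ a) rewrite arc⁺ a = refl
  link⁺ u v (inj₂ a) = trans (∨-comm (arc u v) (arc v u)) (cong (_∨ arc u v) (arc⁺ a))

  -- Elimination order, bipartition and degeneracy

  rank : Node → ℕ
  rank (pend _ _)         = 0
  rank (core (spoke _ _)) = 1
  rank (core (hub _))     = 2
  rank (vert _)           = 3

  arc-rank : ∀ {u v} → Arc u v → rank u < rank v
  arc-rank (pend-core {f = hub j})     = s≤s z≤n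
  arc-rank (pend-core {f = spoke j i}) = s≤s z≤n
  arc-rank spoke-hub                   = s≤s (s≤s z≤n)
  arc-rank (spoke-vert _)              = s≤s (s≤s z≤n)

  rows : List (Fin (suc m))
  rows = allFin (suc m)

  cols : List (Fin n)
  cols = allFin n

  spokes hubs cells : List Cell
  spokes = cartesianProductWith (λ j i → spoke j i) rows cols
  hubs   = map (λ j → hub j) rows
  cells  = spokes ++ hubs

  tags : List Tag
  tags = pendant true ∷ pendant false ∷ centre ∷ []

  front nodes : List Node
  front = cartesianProductWith cell tags cells
  nodes = front ++ map vert cols

  ∈-cells : ∀ f → f ∈ˡ cells
  ∈-cells (hub j)     = ∈-++⁺ʳ spokes (∈-map⁺ _ (∈-allFin j))
  ∈-cells (spoke j i) = ∈-++⁺ˡ (∈-cartesianProductWith⁺ _ (∈-allFin j) (∈-allFin i))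

  ∈-tags : ∀ t → t ∈ˡ tags
  ∈-tags (pendant true)  = here refl
  ∈-tags (pendant false) = there (here refl)
  ∈-tags centre          = there (there (here refl))

  ∈-nodes : ∀ v → v ∈ˡ nodes
  ∈-nodes (cell t f) = ∈-++⁺ˡ (∈-cartesianProductWith⁺ cell (∈-tags t) (∈-cells f))
  ∈-nodes (vert i)   = ∈-++⁺ʳ front (∈-map⁺ vert (∈-allFin i))

  nodes-unique : Unique nodes
  nodes-unique = Unique.++⁺
    (Unique.cartesianProductWith⁺ cell (λ { refl → refl , refl })
      (((λ ()) ∷ (λ ()) ∷ []) ∷ ((λ ()) ∷ []) ∷ [] ∷ [])
      (Unique.++⁺
        (Unique.cartesianProductWith⁺ _ (λ { refl → refl , refl }) (Unique.allFin⁺ (suc m)) (Unique.allFin⁺ n))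
        (Unique.map⁺ (λ { refl → refl }) (Unique.allFin⁺ (suc m)))
        λ (p , q) → spoke≢hub (∈-cartesianProductWith⁻ _ rows cols p) (∈-map⁻ _ q)))
    (Unique.map⁺ (λ { refl → refl }) (Unique.allFin⁺ n))
    λ (p , q) → cell≢vert (∈-cartesianProductWith⁻ cell tags cells p) (∈-map⁻ vert q)
    where
    spoke≢hub : ∀ {f} → (∃[ j ] ∃[ i ] (j ∈ˡ rows × i ∈ˡ cols × f ≡ spoke j i)) →
      ¬ (∃[ j ] (j ∈ˡ rows × f ≡ hub j))
    spoke≢hub (_ , _ , _ , _ , refl) (_ , _ , ())
    cell≢vert : ∀ {v} → (∃[ t ] ∃[ f ] (t ∈ˡ tags × f ∈ˡ cells × v ≡ cell t f)) →
      ¬ (∃[ i ] (i ∈ˡ cols × v ≡ vert i))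
    cell≢vert (_ , _ , _ , _ , refl) (_ , _ , ())

  Sorted : List Node → Set
  Sorted = AllPairs (λ u v → rank u ≤ rank v)

  sorted-block : ∀ k {us} → All (λ u → rank u ≡ k) us → Sorted us
  sorted-block k []         = []
  sorted-block k (refl ∷ h) = All.map (≤-reflexive ∘ sym) h ∷ sorted-block k h

  sorted-++ : ∀ k {us vs} → All (λ u → rank u ≡ k) us → All (λ v → k ≤ rank v) vs → Sorted vs → Sorted (us ++ vs)
  sorted-++ k us≡k k≤vs vs↗ = AllPairs.++⁺ (sorted-block k us≡k) vs↗
    (All.map (λ u≡k → All.map (≤-trans (≤-reflexive u≡k)) k≤vs) us≡k)

  -- One list serves two purposes: sorted by `rank`, it is an elimination order as it stands, and
  -- since it ends with the vertices of the hypergraph, solutions are read off by deleting a prefix.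
  nodes-sorted : Sorted nodes
  nodes-sorted = subst Sorted (sym shape)
    (sorted-++ 0 (pends true) (All.tabulate (λ _ → z≤n))
      (sorted-++ 0 (pends false) (All.tabulate (λ _ → z≤n))
        (sorted-++ 1 spokes≡1 (All.++⁺ (All.map (λ eq → ≤-trans (s≤s z≤n) (≤-reflexive (sym eq))) hubs≡2)
                                       (All.map (λ eq → ≤-trans (s≤s z≤n) (≤-reflexive (sym eq))) verts≡3))
          (sorted-++ 2 hubs≡2 (All.map (λ eq → ≤-trans (s≤s (s≤s z≤n)) (≤-reflexive (sym eq))) verts≡3)
            (sorted-block 3 verts≡3)))))
    where
    pends : ∀ b → All (λ u → rank u ≡ 0) (map (cell (pendant b)) cells)
    pends b = All.map⁺ (All.tabulate (λ _ → refl))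
    spokes≡1 : All (λ u → rank u ≡ 1) (map (cell centre) spokes)
    spokes≡1 = All.map⁺ (All.tabulate λ f∈ → aux (∈-cartesianProductWith⁻ _ rows cols f∈))
      where
      aux : ∀ {f} → (∃[ j ] ∃[ i ] (j ∈ˡ rows × i ∈ˡ cols × f ≡ spoke j i)) → rank (core f) ≡ 1
      aux (_ , _ , _ , _ , refl) = refl
    hubs≡2 : All (λ u → rank u ≡ 2) (map (cell centre) hubs)
    hubs≡2 = All.map⁺ (All.map⁺ (All.tabulate (λ _ → refl)))
    verts≡3 : All (λ u → rank u ≡ 3) (map vert cols)
    verts≡3 = All.map⁺ (All.tabulate (λ _ → refl))
    shape : nodes ≡ map (cell (pendant true)) cells ++ (map (cell (pendant false)) cells ++
      (map (cell centre) spokes ++ (map (cell centre) hubs ++ map vert cols)))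
    shape = trans (++-assoc (map (cell (pendant true)) cells) _ _)
      (cong (map (cell (pendant true)) cells ++_)
        (trans (++-assoc (map (cell (pendant false)) cells) _ _)
          (cong (map (cell (pendant false)) cells ++_)
            (trans (cong (_++ map vert cols) (trans (++-identityʳ _) (map-++ (cell centre) spokes hubs)))
              (++-assoc (map (cell centre) spokes) _ _)))))

  at : Fin (length nodes) → Node
  at = List.lookup nodes

  idx : Node → Fin (length nodes)
  idx v = Any.index (∈-nodes v)

  at-idx : ∀ v → at (idx v) ≡ v
  at-idx v = sym (lookup-index (∈-nodes v))

  idx-at : ∀ i → idx (at i) ≡ i
  idx-at i = lookup-unique nodes-unique (at-idx (at i))

  at⇒idx : ∀ {i v} → at i ≡ v → idx v ≡ i
  at⇒idx {i} refl = idx-at i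

  arc-irreflexive : ∀ v → arc v v ≡ false
  arc-irreflexive (pend _ _)         = refl
  arc-irreflexive (core (hub _))     = refl
  arc-irreflexive (core (spoke _ _)) = refl
  arc-irreflexive (vert _)           = refl

  graph : Graph
  graph = record
    { order       = length nodes
    ; adj         = λ i j → link (at i) (at j)
    ; symmetric   = λ i j → ∨-comm (arc (at i) (at j)) (arc (at j) (at i))
    ; irreflexive = λ i → cong (λ b → b ∨ b) (arc-irreflexive (at i))
    }

  open Graph graph using (order; adj; Adj)

  adj⁻ : ∀ {i j} → Adj i j → Link (at i) (at j)
  adj⁻ a = link⁻ _ _ (to T-≡ a)

  adj⁺ : ∀ {u v} → Link u v → Adj (idx u) (idx v)
  adj⁺ {u} {v} l = from T-≡ (subst₂ (λ x y → link x y ≡ true) (sym (at-idx u)) (sym (at-idx v)) (link⁺ u v l))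

  side : Node → Bool
  side (core (hub _))     = true
  side (core (spoke _ _)) = false
  side (vert _)           = true
  side (pend _ (hub _))   = false
  side (pend _ (spoke _ _)) = true

  arc-side : ∀ {u v} → Arc u v → side u ≢ side v
  arc-side (pend-core {f = hub _})     ()
  arc-side (pend-core {f = spoke _ _}) ()
  arc-side spoke-hub                   ()
  arc-side (spoke-vert _)              ()

  bipartite : Bipartite graph
  bipartite = side ∘ at , λ i j a → [ arc-side , (λ r → arc-side r ∘ sym) ]′ (adj⁻ {i} {j} a)

  -- The two candidates for heads of arcs leaving a node. Where there are fewer, the node itself is
  -- a harmless default, as only an upper bound is counted.
  out₁ out₂ : Node → Node
  out₁ (pend _ f)         = core f
  out₁ (core (spoke j i)) = core (hub j)
  out₁ v                  = v
  out₂ (core (spoke j i)) = vert i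
  out₂ v                  = v

  arc-out : ∀ {u v} → Arc u v → v ≡ out₁ u ⊎ v ≡ out₂ u
  arc-out pend-core      = inj₁ refl
  arc-out spoke-hub      = inj₁ refl
  arc-out (spoke-vert _) = inj₂ refl

  rank-mono : ∀ {i j} → i Fin.≤ j → rank (at i) ≤ rank (at j)
  rank-mono {i} {j} i≤j with m≤n⇒m<n∨m≡n i≤j
  ... | inj₁ i<j = lookup-pairs nodes-sorted {i} {j} i<j
  ... | inj₂ i≡j = ≤-reflexive (cong (rank ∘ at) (toℕ-injective i≡j))

  degenerate : Degenerate graph 2
  degenerate = Permutation.id , λ i → at-most-two _ (idx (out₁ (at i))) (idx (out₂ (at i))) (later i)
    where
    later : ∀ i j → does (i ≤? j) ∧ adj i j ≡ true → j ≡ idx (out₁ (at i)) ⊎ j ≡ idx (out₂ (at i))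
    later i j eq with ∧-true {does (i ≤? j)} eq
    ... | i≤j , a with link⁻ (at i) (at j) a
    -- An arc from the later node back to the earlier one would decrease `rank` along the sorted
    -- list.
    ... | inj₂ r = contradiction (rank-mono {i} {j} (does-true {a? = i ≤? j} i≤j)) (<⇒≱ (arc-rank r))
    ... | inj₁ r with arc-out r
    ... | inj₁ e = inj₁ (sym (at⇒idx e))
    ... | inj₂ e = inj₂ (sym (at⇒idx e))

  -- Row zero is left out because it is no hyperedge of the instance: without hyperedges the empty
  -- set has to qualify.
  Hits : Subset n → Set
  Hits X = ∀ j → ∃[ i ] bit (suc j) i ≡ true × i ∈ X

  member : Subset n → Node → Bool
  member X (pend _ _) = false
  member X (core _)   = true
  member X (vert i)   = lookup X i

  embed : Subset n → Subset order
  embed X = tabulate (member X ∘ at)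

  extract : Subset order → Subset n
  extract D = tabulate (λ i → lookup D (idx (vert i)))

  embed⁺ : ∀ X {i v} → at i ≡ v → member X v ≡ true → i ∈ embed X
  embed⁺ X refl = ∈-tabulate⁺ (member X ∘ at)

  embed⁻ : ∀ X {i v} → at i ≡ v → i ∈ embed X → member X v ≡ true
  embed⁻ X refl = ∈-tabulate⁻ (member X ∘ at)

  idx∈embed⁺ : ∀ X v → member X v ≡ true → idx v ∈ embed X
  idx∈embed⁺ X v = embed⁺ X (at-idx v)

  extract⁺ : ∀ D {i} → idx (vert i) ∈ D → i ∈ extract D
  extract⁺ D h = ∈-tabulate⁺ _ ([]=⇒lookup h)

  extract⁻ : ∀ D {i} → i ∈ extract D → idx (vert i) ∈ D
  extract⁻ D h = lookup⇒[]= _ D (∈-tabulate⁻ _ h)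

  extract-embed : ∀ X → extract (embed X) ≡ X
  extract-embed X = trans
    (tabulate-cong λ i → trans (lookup∘tabulate (member X ∘ at) (idx (vert i))) (cong (member X) (at-idx (vert i))))
    (tabulate∘lookup X)

  -- From connected dominating sets to transversals

  module _ (D : Subset order) (cds : ConnectedDominating graph D) where

    -- Otherwise both pendants of f lie in D, where neither has a neighbour.
    core∈ : ∀ f → idx (core f) ∈ D
    core∈ f with idx (core f) ∈? D
    ... | yes core∈D = core∈D
    ... | no  core∉D with proj₂ (proj₂ cds) _ _ (pend∈ true) (pend∈ false)
      where
      neighbour : ∀ {b j} → Adj (idx (pend b f)) j → j ∉ D
      neighbour {b} {j} a j∈D with at j in eq | subst (λ u → Link u (at j)) (at-idx (pend b f)) (adj⁻ a)
      ... | _ | inj₁ pend-core = core∉D (subst (_∈ D) (sym (at⇒idx eq)) j∈D)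
      pend∈ : ∀ b → idx (pend b f) ∈ D
      pend∈ b with idx (pend b f) ∈? D
      ... | yes p = p
      ... | no  p with proj₁ cds _ p
      ... | j , j∈D , a = contradiction j∈D (neighbour a)
    ... | s = ⊥-elim (isolated s refl refl)
      where
      isolated : ∀ {i j} → Star (InducedAdj graph D) i j → i ≡ idx (pend true f) → j ≢ idx (pend false f)
      isolated ε refl eq with trans (sym (at-idx (pend true f))) (trans (cong at eq) (at-idx (pend false f)))
      ... | ()
      isolated (_◅_ {j = j} (_ , j∈D , a) _) refl _
        with at j in eq | subst (λ u → Link u (at j)) (at-idx (pend true f)) (adj⁻ a)
      ... | _ | inj₁ pend-core = core∉D (subst (_∈ D) (sym (at⇒idx eq)) j∈D)

    InRow : Fin (suc m) → Node → Set
    InRow j (cell _ (j′ , _)) = j′ ≡ j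
    InRow j (vert _)          = ⊥

    leave-row : ∀ {j u v} → Link u v → InRow j u → InRow j v ⊎ ∃[ i ] bit j i ≡ true × v ≡ vert i
    leave-row (inj₁ pend-core)      eq   = inj₁ eq
    leave-row (inj₁ spoke-hub)      eq   = inj₁ eq
    leave-row (inj₁ (spoke-vert b)) refl = inj₂ (_ , b , refl)
    leave-row (inj₂ pend-core)      eq   = inj₁ eq
    leave-row (inj₂ spoke-hub)      eq   = inj₁ eq

    -- All neighbours of a row's cells outside the row are vertices incident with it, so the first
    -- node of the path outside the row is such a vertex, and it lies in `D` with the rest of the
    -- path.
    crossing : ∀ {j k l} → Star (InducedAdj graph D) k l → InRow j (at k) → ¬ InRow j (at l) →
      ∃[ i ] bit j i ≡ true × idx (vert i) ∈ D
    crossing ε                     p ¬p = contradiction p ¬p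
    crossing ((_ , k∈D , a) ◅ s) p ¬p with leave-row (adj⁻ a) p
    ... | inj₁ q           = crossing s q ¬p
    ... | inj₂ (i , b , e) = i , b , subst (_∈ D) (sym (at⇒idx e)) k∈D

    -- Both hubs are forced into `D`, so a path inside `D` leads from the hub of the row to that of
    -- row zero and has to leave the row.
    extract-hits : Hits (extract D)
    extract-hits j
      with crossing {suc j} (proj₂ (proj₂ cds) _ _ (core∈ (hub (suc j))) (core∈ (hub zero)))
        (subst (InRow (suc j)) (sym (at-idx (core (hub (suc j))))) refl)
        (λ p → 0≢suc (subst (InRow (suc j)) (at-idx (core (hub zero))) p))
      where
      0≢suc : ¬ (Fin.zero {m} ≡ suc j)
      0≢suc ()
    ... | i , b , i∈D = i , b , extract⁺ D i∈D

    embed-extract⊆ : embed (extract D) ⊆ D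
    embed-extract⊆ {i} i∈ with at i in eq
    ... | pend _ _ = contradiction (embed⁻ (extract D) eq i∈) λ ()
    ... | core f   = subst (_∈ D) (at⇒idx eq) (core∈ f)
    ... | vert k   = subst (_∈ D) (at⇒idx eq)
      (extract⁻ D (lookup⇒[]= k (extract D) (embed⁻ (extract D) eq i∈)))

  -- From transversals to connected dominating sets

  module _ (X : Subset n) (hits : Hits X) where

    In : Node → Set
    In v = member X v ≡ true

    InLink : Node → Node → Set
    InLink u v = In u × In v × Link u v

    dominator : ∀ v → ¬ In v → ∃[ u ] In u × Link v u
    dominator (pend b f) _ = core f , refl , inj₁ pend-core
    dominator (core f)   h = contradiction refl h
    -- Row zero contains every vertex, even one that lies in no hyperedge.
    dominator (vert i)   _ = core (spoke zero i) , refl , inj₂ (spoke-vert (bit-zero i))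

    root : Node
    root = core (hub zero)

    vert-to-root : ∀ i → In (vert i) → Star InLink (vert i) root
    vert-to-root i h =
      (h , refl , inj₂ (spoke-vert (bit-zero i))) ◅ (refl , refl , inj₁ spoke-hub) ◅ ε

    hub-to-root : ∀ j → Star InLink (core (hub j)) root
    hub-to-root zero = ε
    hub-to-root (suc j) with hits j
    ... | i , b , i∈X =
      (refl , refl , inj₂ spoke-hub) ◅ (refl , []=⇒lookup i∈X , inj₁ (spoke-vert b)) ◅
      vert-to-root i ([]=⇒lookup i∈X)

    to-root : ∀ v → In v → Star InLink v root
    to-root (core (hub j))     _ = hub-to-root j
    to-root (core (spoke j i)) _ = (refl , refl , inj₁ spoke-hub) ◅ hub-to-root j
    to-root (vert i)           h = vert-to-root i h

    embed-cds : ConnectedDominating graph (embed X)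
    embed-cds = dominating , (idx root , idx∈embed⁺ X root refl) , connected
      where
      dominating : Dominating graph (embed X)
      dominating i i∉ with dominator (at i) (i∉ ∘ embed⁺ X refl)
      ... | u , u∈ , l = idx u , idx∈embed⁺ X u u∈ , subst (λ j → Adj j (idx u)) (idx-at i) (adj⁺ l)
      path : ∀ u v → In u → In v → Star InLink u v
      path u v u∈ v∈ = to-root u u∈ ◅◅ Star.reverse (λ (a , b , l) → b , a , swap l) (to-root v v∈)
      connected : ∀ i j → i ∈ embed X → j ∈ embed X → Star (InducedAdj graph (embed X)) i j
      connected i j i∈ j∈ = subst₂ (Star (InducedAdj graph (embed X))) (idx-at i) (idx-at j)
        (Star.gmap idx (λ {u} {v} (a , b , l) → idx∈embed⁺ X u a , idx∈embed⁺ X v b , adj⁺ l)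
          (path (at i) (at j) (embed⁻ X refl i∈) (embed⁻ X refl j∈)))

  embed-mono : ∀ {X Y} → X ⊆ Y → embed X ⊆ embed Y
  embed-mono {X} {Y} X⊆Y {i} i∈ with at i in eq
  ... | pend _ _ = contradiction (embed⁻ X eq i∈) λ ()
  ... | core _   = embed⁺ Y eq refl
  ... | vert k   = embed⁺ Y eq ([]=⇒lookup (X⊆Y (lookup⇒[]= k X (embed⁻ X eq i∈))))

  embed-vert⁻ : ∀ X {i} → idx (vert i) ∈ embed X → i ∈ X
  embed-vert⁻ X {i} h = lookup⇒[]= i X (embed⁻ X (at-idx (vert i)) h)

  embed-strict : ∀ {X Y} → X ⊂ Y → embed X ⊂ embed Y
  embed-strict {X} {Y} (X⊆Y , i , i∈Y , i∉X) =
    embed-mono X⊆Y , idx (vert i) , idx∈embed⁺ Y (vert i) ([]=⇒lookup i∈Y) , i∉X ∘ embed-vert⁻ X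

  -- The embedded extract is a connected dominating set inside `D`, so minimality forces equality;
  -- in particular `D` contains no pendants.
  embed-extract : ∀ D → Minimal (ConnectedDominating graph) D → embed (extract D) ≡ D
  embed-extract D (cds , minimal) = ⊆-antisym (embed-extract⊆ D cds) D⊆
    where
    D⊆ : D ⊆ embed (extract D)
    D⊆ {i} i∈D with i ∈? embed (extract D)
    ... | yes i∈ = i∈
    ... | no  i∉ = contradiction (embed-cds (extract D) (extract-hits D cds))
      (minimal _ (embed-extract⊆ D cds , i , i∈D , i∉))

  extract-minimal : ∀ D → Minimal (ConnectedDominating graph) D → Minimal Hits (extract D)
  extract-minimal D (cds , minimal) = extract-hits D cds , λ Y Y⊂ hits →
    minimal (embed Y) (subst (embed Y ⊂_) (embed-extract D (cds , minimal)) (embed-strict Y⊂)) (embed-cds Y hits)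

  embed-minimal : ∀ X → Minimal Hits X → Minimal (ConnectedDominating graph) (embed X)
  embed-minimal X (hits , minimal) = embed-cds X hits , λ D (D⊆ , i , i∈ , i∉) cds →
    minimal (extract D)
      ((λ k∈ → embed-vert⁻ X (D⊆ (extract⁻ D k∈))) , missing D cds i i∈ i∉)
      (extract-hits D cds)
    where
    -- The node absent from `D` is not a pendant, as `embed X` has none, and not a core, as those
    -- are forced. So it is a vertex, and the extract shrinks strictly as well.
    missing : ∀ D → ConnectedDominating graph D → ∀ i → i ∈ embed X → i ∉ D → ∃[ k ] k ∈ X × k ∉ extract D
    missing D cds i i∈ i∉ with at i in eq
    ... | pend _ _ = contradiction (embed⁻ X eq i∈) λ ()
    ... | core f   = contradiction (subst (_∈ D) (at⇒idx eq) (core∈ D cds f)) i∉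
    ... | vert k   = k , lookup⇒[]= k X (embed⁻ X eq i∈) , λ k∈ → i∉ (subst (_∈ D) (at⇒idx eq) (extract⁻ D k∈))

-- Computing the adjacency matrix

-- A vertex of the graph is represented as kind · (row · column).  A row is a
-- nonempty suffix of the list of hyperedges, a column one of the bit list of a
-- hyperedge; their lengths serve as indices and their heads as contents.
-- Hubs have an empty column, and the vertices of the hypergraph an empty row.
arcᶠ linkᶠ : PolyFun
arcᶠ =
  ifᶠ kind′ nilᶠ
    (ifᶠ kind (ifᶠ sameRow sameCol nilᶠ)
      (ifᶠ row′ (ifᶠ col′ nilᶠ (ifᶠ col sameRow nilᶠ))
        (ifᶠ (hdᶠ ∘ᶠ col) sameCol nilᶠ)))
  where
  kind  = hdᶠ ∘ᶠ hdᶠ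
  row   = hdᶠ ∘ᶠ tlᶠ ∘ᶠ hdᶠ
  col   = tlᶠ ∘ᶠ tlᶠ ∘ᶠ hdᶠ
  kind′ = hdᶠ ∘ᶠ tlᶠ
  row′  = hdᶠ ∘ᶠ tlᶠ ∘ᶠ tlᶠ
  col′  = tlᶠ ∘ᶠ tlᶠ ∘ᶠ tlᶠ
  sameRow = sameLengthᶠ ∘ᶠ ⟪ row , row′ ⟫
  sameCol = sameLengthᶠ ∘ᶠ ⟪ col , col′ ⟫
linkᶠ = ifᶠ arcᶠ trueᶠ (arcᶠ ∘ᶠ ⟪ tlᶠ , hdᶠ ⟫)

-- Concatenation as a flat map over a two-element list: `tlᶠ` discards the dummy environment and
-- returns each list unchanged.
appendᶠ : PolyFun → PolyFun → PolyFun
appendᶠ f g = flatMapᶠ tlᶠ ∘ᶠ ⟪ nilᶠ , ⟪ f , ⟪ g , nilᶠ ⟫ ⟫ ⟫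

-- These follow the lists of `Incidence` one by one. Row zero arises by replacing each element of
-- the unary vertex count by a true bit. A swap `⟪ tlᶠ , hdᶠ ⟫` turns the current element into the
-- environment of an inner map. As prefix, `frontᶠ` matters only through its length.
hyperedgesᶠ rowsᶠ spokesInᶠ spokesᶠ hubsᶠ cellsᶠ tagsᶠ taggedᶠ frontᶠ vertsᶠ nodesᶠ matrixᶠ reductionᶠ : PolyFun
hyperedgesᶠ = ⟪ mapᶠ trueᶠ ∘ᶠ ⟪ nilᶠ , hdᶠ ⟫ , tlᶠ ⟫
rowsᶠ       = tailsᶠ ∘ᶠ hyperedgesᶠ
spokesInᶠ   = mapᶠ idᶠ ∘ᶠ ⟪ tlᶠ , tailsᶠ ∘ᶠ hdᶠ ∘ᶠ tlᶠ ⟫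
spokesᶠ     = flatMapᶠ spokesInᶠ ∘ᶠ ⟪ nilᶠ , rowsᶠ ⟫
hubsᶠ       = mapᶠ ⟪ tlᶠ , nilᶠ ⟫ ∘ᶠ ⟪ nilᶠ , rowsᶠ ⟫
cellsᶠ      = appendᶠ spokesᶠ hubsᶠ
tagsᶠ       = ⟪ trueᶠ , ⟪ trueᶠ , ⟪ nilᶠ , nilᶠ ⟫ ⟫ ⟫
taggedᶠ     = mapᶠ idᶠ ∘ᶠ ⟪ tlᶠ , hdᶠ ⟫
frontᶠ      = flatMapᶠ taggedᶠ ∘ᶠ ⟪ cellsᶠ , tagsᶠ ⟫
vertsᶠ      = mapᶠ ⟪ nilᶠ , ⟪ nilᶠ , tlᶠ ⟫ ⟫ ∘ᶠ ⟪ nilᶠ , tailsᶠ ∘ᶠ hdᶠ ⟫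
nodesᶠ      = appendᶠ frontᶠ vertsᶠ
matrixᶠ     = mapᶠ (mapᶠ linkᶠ ∘ᶠ ⟪ tlᶠ , hdᶠ ⟫) ∘ᶠ ⟪ idᶠ , idᶠ ⟫
reductionᶠ  = ⟪ frontᶠ , matrixᶠ ∘ᶠ nodesᶠ ⟫

appendᶠ-correct : ∀ f g v {xs ys} → fun f v ≡ list xs → fun g v ≡ list ys →
  fun (appendᶠ f g) v ≡ list (xs ++ ys)
appendᶠ-correct f g v {xs} {ys} fv gv = begin
  fun (flatMapᶠ tlᶠ) (nil · fun f v · fun g v · nil)
    ≡⟨ cong₂ (λ s t → fun (flatMapᶠ tlᶠ) (nil · s · t · nil)) fv gv ⟩
  fun (flatMapᶠ tlᶠ) (nil · list xs · list ys · nil)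
    ≡⟨ flatMapᶠ-correct tlᶠ nil list id (λ _ → refl) (xs ∷ ys ∷ []) ⟩
  list (xs ++ ys ++ [])
    ≡⟨ cong (λ zs → list (xs ++ zs)) (++-identityʳ ys) ⟩
  list (xs ++ ys) ∎
  where open ≡-Reasoning

cond-≢nil : ∀ {t} a b → t ≢ nil → cond t a b ≡ a
cond-≢nil {nil}   a b t≢nil = contradiction refl t≢nil
cond-≢nil {_ · _} a b t≢nil = refl

-- Suffixes of lists as indices

suffix : List Tree → ∀ {n} → Fin n → Tree
suffix xs i = list (drop (toℕ i) xs)

suffix-head : ∀ {A : Set} (f : A → Tree) xs i → head (suffix (map f xs) i) ≡ f (List.lookup xs i)
suffix-head f (x ∷ xs) zero    = refl
suffix-head f (x ∷ xs) (suc i) = suffix-head f xs i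

suffix≢nil : ∀ {n} xs → length xs ≡ n → (i : Fin n) → suffix xs i ≢ nil
suffix≢nil []       refl ()
suffix≢nil (x ∷ xs) refl zero    ()
suffix≢nil (x ∷ xs) refl (suc i) = suffix≢nil xs refl i

applyUpTo-toℕ : ∀ {A : Set} (f : ℕ → A) n → applyUpTo f n ≡ map (f ∘ toℕ) (allFin n)
applyUpTo-toℕ f n = trans (go f n) (sym (map-tabulate id (f ∘ toℕ)))
  where
  go : ∀ {A : Set} (f : ℕ → A) n → applyUpTo f n ≡ List.tabulate {n = n} (f ∘ toℕ)
  go f zero    = refl
  go f (suc n) = cong (f 0 ∷_) (go (f ∘ suc) n)

tailsᶠ-suffixes : ∀ {n} xs → length xs ≡ n → fun tailsᶠ (list xs) ≡ list (map (suffix xs) (allFin n))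
tailsᶠ-suffixes xs refl = trans (tailsᶠ-correct xs) (cong list (applyUpTo-toℕ _ (length xs)))

-- The suffix at index `i` has length `n ∸ toℕ i`, which determines `i`. The contents are never
-- compared, so indices into different lists of equal length can be matched, such as bit lists of
-- two rows.
sameLengthᶠ-suffix : ∀ {n} xs ys → length xs ≡ n → length ys ≡ n → (i j : Fin n) →
  fun sameLengthᶠ (suffix xs i · suffix ys j) ≡ encodeBool (does (i ≟ j))
sameLengthᶠ-suffix {n} xs ys refl ys≡n i j = trans (sameLengthᶠ-correct (drop (toℕ i) xs) (drop (toℕ j) ys))
  (cong encodeBool (does-⇔ (mk⇔ equal (λ { refl → trans (len xs refl i) (sym (len ys ys≡n i)) }))
    (length (drop (toℕ i) xs) ℕ.≟ length (drop (toℕ j) ys)) (i ≟ j)))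
  where
  len : ∀ zs → length zs ≡ n → (k : Fin n) → length (drop (toℕ k) zs) ≡ n ∸ toℕ k
  len zs eq k = trans (length-drop (toℕ k) zs) (cong (_∸ toℕ k) eq)
  equal : length (drop (toℕ i) xs) ≡ length (drop (toℕ j) ys) → i ≡ j
  equal eq = toℕ-injective (∸-cancelˡ-≡ (toℕ≤n i) (toℕ≤n j)
    (trans (sym (len xs refl i)) (trans eq (len ys ys≡n j))))

sameLengthᶠ-suffix-nil : ∀ {n} xs → length xs ≡ n → (i : Fin n) →
  fun sameLengthᶠ (suffix xs i · nil) ≡ nil × fun sameLengthᶠ (nil · suffix xs i) ≡ nil
sameLengthᶠ-suffix-nil (x ∷ xs) refl zero    =
  sameLengthᶠ-correct (x ∷ xs) [] , sameLengthᶠ-correct [] (x ∷ xs)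
sameLengthᶠ-suffix-nil (x ∷ xs) refl (suc i) = sameLengthᶠ-suffix-nil xs refl i

map-cartesianProductWith : ∀ {A B C D : Set} (g : C → D) (f : A → B → C) xs ys →
  map g (cartesianProductWith f xs ys) ≡ concatMap (λ x → map (λ y → g (f x y)) ys) xs
map-cartesianProductWith g f []       ys = refl
map-cartesianProductWith g f (x ∷ xs) ys = trans (map-++ g (map (f x) ys) _)
  (cong₂ _++_ (sym (map-∘ ys)) (map-cartesianProductWith g f xs ys))

toList-tabulate : ∀ {A : Set} {n} (f : Fin n → A) → toList (tabulate f) ≡ map f (allFin n)
toList-tabulate f = trans (go f) (sym (map-tabulate id f))
  where
  go : ∀ {A : Set} {n} (f : Fin n → A) → toList (tabulate f) ≡ List.tabulate f
  go {n = zero}  f = refl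
  go {n = suc n} f = cong (f zero ∷_) (go (f ∘ suc))

toList-tabulate-lookup : ∀ {A B : Set} (f : A → B) xs → toList (tabulate (f ∘ List.lookup xs)) ≡ map f xs
toList-tabulate-lookup f []       = refl
toList-tabulate-lookup f (x ∷ xs) = cong (f x ∷_) (toList-tabulate-lookup f xs)

encodeSubset-list : ∀ {n} (X : Subset n) → encodeSubset X ≡ list (map encodeBool (toList X))
encodeSubset-list X = encodeList-list encodeBool (toList X)

strip-++ : ∀ xs ys zs → length xs ≡ length ys → strip (list xs) (list (ys ++ zs)) ≡ list zs
strip-++ []       []       zs eq = refl
strip-++ (x ∷ xs) (y ∷ ys) zs eq = strip-++ xs ys zs (suc-injective eq)

encodeℕ-list : ∀ n → encodeℕ n ≡ list (replicate n nil)
encodeℕ-list zero    = refl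
encodeℕ-list (suc n) = cong (nil ·_) (encodeℕ-list n)

encodeSubset-full : ∀ n → encodeSubset (Vec.replicate n true) ≡ list (replicate n (nil · nil))
encodeSubset-full zero    = refl
encodeSubset-full (suc n) = cong ((nil · nil) ·_) (encodeSubset-full n)

-- Agreement of the computed matrix with the graph

module FromHypergraph (H : Hypergraph) where
  open Hypergraph H renaming (order to n)

  hyperedges : List (Subset n)
  hyperedges = Vec.replicate n true ∷ edges

  m : ℕ
  m = length edges

  bit : Fin (suc m) → Fin n → Bool
  bit j i = lookup (List.lookup hyperedges j) i

  open Incidence n m bit (λ i → lookup-replicate i true) public

  rowTrees : List Tree
  rowTrees = map encodeSubset hyperedges

  rowTrees-length : length rowTrees ≡ suc m
  rowTrees-length = length-map encodeSubset hyperedges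

  bits : Fin (suc m) → List Tree
  bits j = map encodeBool (toList (List.lookup hyperedges j))

  bits-length : ∀ j → length (bits j) ≡ n
  bits-length j = trans (length-map encodeBool (toList (List.lookup hyperedges j))) (length-toList (List.lookup hyperedges j))

  unary : List Tree
  unary = replicate n nil

  rowTree : Fin (suc m) → Tree
  rowTree = suffix rowTrees

  colTree : Fin (suc m) → Fin (suc n) → Tree
  colTree j zero    = nil
  colTree j (suc i) = suffix (bits j) i

  cellTree : Cell → Tree
  cellTree (j , c) = rowTree j · colTree j c

  -- Both pendants of a cell get the same tree: adjacency does not distinguish them, and they remain
  -- separate entries of the list.
  tagTree : Tag → Tree
  tagTree (pendant _) = nil · nil
  tagTree centre      = nil

  nodeTree : Node → Tree
  nodeTree (cell t f) = tagTree t · cellTree f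
  nodeTree (vert i)   = nil · nil · suffix unary i

  rowTree-head : ∀ j → head (rowTree j) ≡ list (bits j)
  rowTree-head j = trans (suffix-head encodeSubset hyperedges j) (encodeSubset-list (List.lookup hyperedges j))

  colTree-head : ∀ j i → head (suffix (bits j) i) ≡ encodeBool (bit j i)
  colTree-head j i = go (List.lookup hyperedges j) i
    where
    go : ∀ {n} (X : Subset n) i → head (suffix (map encodeBool (toList X)) i) ≡ encodeBool (lookup X i)
    go (x ∷ X) zero    = refl
    go (x ∷ X) (suc i) = go X i

  -- With nil entries in the column of a vertex, the bit test of `arcᶠ` fails there, so no vertex is
  -- joined to itself or to another vertex.
  unary-head : ∀ i → head (suffix unary i) ≡ nil
  unary-head = go
    where
    go : ∀ {n} (i : Fin n) → head (suffix (replicate n nil) i) ≡ nil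
    go zero    = refl
    go (suc i) = go i

  sameRow : ∀ j j′ → fun sameLengthᶠ (rowTree j · rowTree j′) ≡ encodeBool (does (j ≟ j′))
  sameRow = sameLengthᶠ-suffix rowTrees rowTrees rowTrees-length rowTrees-length

  sameCol : ∀ j j′ c c′ → fun sameLengthᶠ (colTree j c · colTree j′ c′) ≡ encodeBool (does (c ≟ c′))
  sameCol j j′ zero    zero     = sameLengthᶠ-correct [] []
  sameCol j j′ zero    (suc i′) = proj₂ (sameLengthᶠ-suffix-nil (bits j′) (bits-length j′) i′)
  sameCol j j′ (suc i) zero     = proj₁ (sameLengthᶠ-suffix-nil (bits j) (bits-length j) i)
  sameCol j j′ (suc i) (suc i′) = sameLengthᶠ-suffix (bits j) (bits j′) (bits-length j) (bits-length j′) i i′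

  rowTree≢nil : ∀ j → rowTree j ≢ nil
  rowTree≢nil = suffix≢nil rowTrees rowTrees-length

  arcᶠ-correct : ∀ u v → fun arcᶠ (nodeTree u · nodeTree v) ≡ encodeBool (arc u v)
  arcᶠ-correct (pend b f)         (pend b′ f′) = refl
  arcᶠ-correct (core (hub j))     (pend b′ f′) = refl
  arcᶠ-correct (core (spoke j i)) (pend b′ f′) = refl
  arcᶠ-correct (vert i)           (pend b′ f′) = refl
  arcᶠ-correct (pend b (j , c)) (core (j′ , c′))
    rewrite sameRow j j′ | sameCol j j′ c c′ = cond-∧ (does (j ≟ j′)) (does (c ≟ c′))
  arcᶠ-correct (pend b (j , c)) (vert i′)
    rewrite proj₁ (sameLengthᶠ-suffix-nil rowTrees rowTrees-length j) = refl
  arcᶠ-correct (core (hub j)) (core (hub j′)) = cond-≢nil _ _ (rowTree≢nil j′)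
  arcᶠ-correct (core (hub j)) (core (spoke j′ i′)) = trans (cond-≢nil _ _ (rowTree≢nil j′))
    (cond-≢nil _ _ (suffix≢nil (bits j′) (bits-length j′) i′))
  arcᶠ-correct (core (spoke j i)) (core (hub j′)) = trans (cond-≢nil _ _ (rowTree≢nil j′))
    (trans (cond-≢nil _ _ (suffix≢nil (bits j) (bits-length j) i)) (sameRow j j′))
  arcᶠ-correct (core (spoke j i)) (core (spoke j′ i′)) = trans (cond-≢nil _ _ (rowTree≢nil j′))
    (cond-≢nil _ _ (suffix≢nil (bits j′) (bits-length j′) i′))
  arcᶠ-correct (vert i) (core (hub j′)) = trans (cond-≢nil _ _ (rowTree≢nil j′))
    (trans (cond-≢nil _ _ (suffix≢nil unary (length-replicate n) i))
      (proj₂ (sameLengthᶠ-suffix-nil rowTrees rowTrees-length j′)))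
  arcᶠ-correct (vert i) (core (spoke j′ i′)) = trans (cond-≢nil _ _ (rowTree≢nil j′))
    (cond-≢nil _ _ (suffix≢nil (bits j′) (bits-length j′) i′))
  arcᶠ-correct (core (hub j)) (vert i′) = refl
  arcᶠ-correct (core (spoke j i)) (vert i′)
    rewrite colTree-head j i | sameLengthᶠ-suffix (bits j) unary (bits-length j) (length-replicate n) i i′
    = cond-∧ (bit j i) (does (i ≟ i′))
  arcᶠ-correct (vert i) (vert i′) rewrite unary-head i = refl

  linkᶠ-correct : ∀ u v → fun linkᶠ (nodeTree u · nodeTree v) ≡ encodeBool (link u v)
  linkᶠ-correct u v = trans
    (cong₂ (λ s t → cond s (nil · nil) t) (arcᶠ-correct u v) (arcᶠ-correct v u))
    (cond-∨ (arc u v) (arc v u))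

  input : Tree
  input = encodeHypergraph H

  hyperedgesᶠ-correct : fun hyperedgesᶠ input ≡ list rowTrees
  hyperedgesᶠ-correct = cong₂ _·_ full (encodeList-list encodeSubset edges)
    where
    open ≡-Reasoning
    full : fun (mapᶠ trueᶠ) (nil · encodeℕ n) ≡ encodeSubset (Vec.replicate n true)
    full = begin
      fun (mapᶠ trueᶠ) (nil · encodeℕ n)
        ≡⟨ cong (λ t → fun (mapᶠ trueᶠ) (nil · t)) (trans (encodeℕ-list n) (cong list (sym (map-replicate (const nil) n tt)))) ⟩
      fun (mapᶠ trueᶠ) (nil · list (map (const nil) (replicate n tt)))
        ≡⟨ mapᶠ-correct trueᶠ nil (const nil) (const (nil · nil)) (λ _ → refl) (replicate n tt) ⟩
      list (map (const (nil · nil)) (replicate n tt))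
        ≡⟨ cong list (map-replicate (const (nil · nil)) n tt) ⟩
      list (replicate n (nil · nil))
        ≡⟨ encodeSubset-full n ⟨
      encodeSubset (Vec.replicate n true) ∎

  rowsᶠ-correct : fun rowsᶠ input ≡ list (map rowTree rows)
  rowsᶠ-correct = trans (cong (fun tailsᶠ) hyperedgesᶠ-correct) (tailsᶠ-suffixes rowTrees rowTrees-length)

  spokesInᶠ-correct : ∀ j → fun spokesInᶠ (nil · rowTree j) ≡ list (map (λ i → cellTree (spoke j i)) cols)
  spokesInᶠ-correct j = trans
    (cong (λ t → fun (mapᶠ idᶠ) (rowTree j · t))
      (trans (cong (fun tailsᶠ) (rowTree-head j)) (tailsᶠ-suffixes (bits j) (bits-length j))))
    (mapᶠ-correct idᶠ (rowTree j) (suffix (bits j)) _ (λ _ → refl) cols)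

  spokesᶠ-correct : fun spokesᶠ input ≡ list (map cellTree spokes)
  spokesᶠ-correct = trans (cong (λ t → fun (flatMapᶠ spokesInᶠ) (nil · t)) rowsᶠ-correct)
    (trans (flatMapᶠ-correct spokesInᶠ nil rowTree _ spokesInᶠ-correct rows)
      (cong list (sym (map-cartesianProductWith cellTree _ rows cols))))

  hubsᶠ-correct : fun hubsᶠ input ≡ list (map cellTree hubs)
  hubsᶠ-correct = trans (cong (λ t → fun (mapᶠ ⟪ tlᶠ , nilᶠ ⟫) (nil · t)) rowsᶠ-correct)
    (trans (mapᶠ-correct ⟪ tlᶠ , nilᶠ ⟫ nil rowTree (λ j → cellTree (hub j)) (λ _ → refl) rows)
      (cong list (map-∘ rows)))

  cellsᶠ-correct : fun cellsᶠ input ≡ list (map cellTree cells)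
  cellsᶠ-correct = trans (appendᶠ-correct spokesᶠ hubsᶠ input spokesᶠ-correct hubsᶠ-correct)
    (cong list (sym (map-++ cellTree spokes hubs)))

  taggedᶠ-correct : ∀ t → fun taggedᶠ (list (map cellTree cells) · tagTree t) ≡
    list (map (λ f → nodeTree (cell t f)) cells)
  taggedᶠ-correct t = mapᶠ-correct idᶠ (tagTree t) cellTree _ (λ _ → refl) cells

  frontᶠ-correct : fun frontᶠ input ≡ list (map nodeTree front)
  frontᶠ-correct = trans (cong (λ t → fun (flatMapᶠ taggedᶠ) (t · list (map tagTree tags))) cellsᶠ-correct)
    (trans (flatMapᶠ-correct taggedᶠ (list (map cellTree cells)) tagTree _ taggedᶠ-correct tags)
      (cong list (sym (map-cartesianProductWith nodeTree cell tags cells))))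

  vertsᶠ-correct : fun vertsᶠ input ≡ list (map nodeTree (map vert cols))
  vertsᶠ-correct = trans
    (cong (λ t → fun (mapᶠ ⟪ nilᶠ , ⟪ nilᶠ , tlᶠ ⟫ ⟫) (nil · t))
      (trans (cong (fun tailsᶠ) (encodeℕ-list n)) (tailsᶠ-suffixes unary (length-replicate n))))
    (trans (mapᶠ-correct ⟪ nilᶠ , ⟪ nilᶠ , tlᶠ ⟫ ⟫ nil (suffix unary) (nodeTree ∘ vert) (λ _ → refl) cols)
      (cong list (map-∘ cols)))

  nodesᶠ-correct : fun nodesᶠ input ≡ list (map nodeTree nodes)
  nodesᶠ-correct = trans (appendᶠ-correct frontᶠ vertsᶠ input frontᶠ-correct vertsᶠ-correct)
    (cong list (sym (map-++ nodeTree front (map vert cols))))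

  linkRow : Node → Tree
  linkRow u = list (map (λ v → encodeBool (link u v)) nodes)

  matrixᶠ-correct : fun matrixᶠ (list (map nodeTree nodes)) ≡ list (map linkRow nodes)
  matrixᶠ-correct = mapᶠ-correct (mapᶠ linkᶠ ∘ᶠ ⟪ tlᶠ , hdᶠ ⟫) (list (map nodeTree nodes)) nodeTree linkRow
    (λ u → mapᶠ-correct linkᶠ (nodeTree u) nodeTree _ (linkᶠ-correct u) nodes) nodes

  encodeGraph-list : encodeGraph graph ≡ list (map linkRow nodes)
  encodeGraph-list = begin
    encodeGraph graph
      ≡⟨ encodeList-list encodeSubset _ ⟩
    list (map encodeSubset (toList (tabulate (row ∘ at))))
      ≡⟨ cong (list ∘ map encodeSubset) (toList-tabulate-lookup row nodes) ⟩
    list (map encodeSubset (map row nodes))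
      ≡⟨ cong list (map-∘ nodes) ⟨
    list (map (encodeSubset ∘ row) nodes)
      ≡⟨ cong list (map-cong encode-row nodes) ⟩
    list (map linkRow nodes) ∎
    where
    open ≡-Reasoning
    row : Node → Subset (length nodes)
    row u = tabulate (λ j → link u (at j))
    encode-row : ∀ u → encodeSubset (row u) ≡ linkRow u
    encode-row u = trans (encodeSubset-list (row u))
      (cong list (trans (cong (map encodeBool) (toList-tabulate-lookup (link u) nodes)) (sym (map-∘ nodes))))

  reductionᶠ-correct : fun reductionᶠ input ≡ list (map nodeTree front) · encodeGraph graph
  reductionᶠ-correct = cong₂ _·_ frontᶠ-correct
    (trans (cong (fun matrixᶠ) nodesᶠ-correct) (trans matrixᶠ-correct (sym encodeGraph-list)))

  strip-front : ∀ X → strip (list (map nodeTree front)) (encodeSubset X) ≡ encodeSubset (extract X)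
  strip-front X = begin
    strip (list (map nodeTree front)) (encodeSubset X)
      ≡⟨ cong (strip (list (map nodeTree front))) (encodeSubset-list X) ⟩
    strip (list (map nodeTree front)) (list (map encodeBool (toList X)))
      ≡⟨ cong (λ bs → strip (list (map nodeTree front)) (list (map encodeBool bs))) split ⟩
    strip (list (map nodeTree front)) (list (map encodeBool (map mem front ++ map mem (map vert cols))))
      ≡⟨ cong (λ ts → strip (list (map nodeTree front)) (list ts)) (map-++ encodeBool (map mem front) _) ⟩
    strip (list (map nodeTree front)) (list (map encodeBool (map mem front) ++ map encodeBool (map mem (map vert cols))))
      ≡⟨ strip-++ (map nodeTree front) (map encodeBool (map mem front)) _ lengths ⟩
    list (map encodeBool (map mem (map vert cols)))
      ≡⟨ cong (list ∘ map encodeBool) (trans (sym (map-∘ cols)) (sym (toList-tabulate (mem ∘ vert)))) ⟩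
    list (map encodeBool (toList (extract X)))
      ≡⟨ encodeSubset-list (extract X) ⟨
    encodeSubset (extract X) ∎
    where
    open ≡-Reasoning
    mem : Node → Bool
    mem v = lookup X (idx v)
    split : toList X ≡ map mem front ++ map mem (map vert cols)
    split = trans (cong toList (trans (sym (tabulate∘lookup X)) (tabulate-cong (λ i → cong (lookup X) (sym (idx-at i))))))
      (trans (toList-tabulate-lookup mem nodes) (map-++ mem front (map vert cols)))
    lengths : length (map nodeTree front) ≡ length (map encodeBool (map mem front))
    lengths = trans (length-map nodeTree front)
      (sym (trans (length-map encodeBool (map mem front)) (length-map mem front)))

  transversal⇔hits : ∀ X → Transversal H X ⇔ Hits X
  transversal⇔hits X = mk⇔ forth back
    where
    forth : Transversal H X → Hits X
    forth t j with All.lookup t (∈-lookup j)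
    ... | i , i∈e , i∈X = i , []=⇒lookup i∈e , i∈X
    back : Hits X → Transversal H X
    back hits = All.tabulate member∈
      where
      member∈ : ∀ {e} → e ∈ˡ edges → ∃[ i ] i ∈ e × i ∈ X
      member∈ e∈ with hits (Any.index e∈)
      ... | i , b , i∈X = i , subst (i ∈_) (sym (lookup-index e∈)) (lookup⇒[]= i _ b) , i∈X

minimal-⇔ : ∀ {n} {P Q : Subset n → Set} → (∀ X → P X ⇔ Q X) → ∀ {X} → Minimal P X → Minimal Q X
minimal-⇔ P⇔Q (p , minimal) = to (P⇔Q _) p , λ Y Y⊂X q → minimal Y Y⊂X (from (P⇔Q Y) q)

-- Four nodes per element: at most three for the bit and one for the list cell.
size-encodeSubset : ∀ {n} (X : Subset n) → size (encodeSubset X) ≤ 1 + 4 * n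
size-encodeSubset {zero}  []      = s≤s z≤n
size-encodeSubset {suc n} (b ∷ X) = ≤-trans
  (s≤s (+-mono-≤ (size-encodeBool b) (size-encodeSubset X))) (≤-reflexive (lemma n))
  where
  size-encodeBool : ∀ b → size (encodeBool b) ≤ 3
  size-encodeBool true  = ≤-refl
  size-encodeBool false = s≤s z≤n
  lemma : ∀ n → 4 + (1 + 4 * n) ≡ 1 + 4 * suc n
  lemma = solve-∀

length≤size-encodeList : ∀ {A : Set} {n} (f : A → Tree) (xs : Vec A n) → n ≤ size (encodeList f (toList xs))
length≤size-encodeList f []       = z≤n
length≤size-encodeList f (x ∷ xs) = s≤s (≤-trans (length≤size-encodeList f xs) (m≤n+m _ (size (f x))))

reduction : Reduction MinimalTransversals (MinimalConnectedDominatingSets TwoDegenerateBipartite)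
reduction = record
  { red         = reductionᶠ
  ; translate   = λ H → F.graph H , F.degenerate H , F.bipartite H
  ; prefix      = λ H → list (map (F.nodeTree H) (F.front H))
  ; red-correct = F.reductionᶠ-correct
  ; embed       = F.embed
  ; extract     = F.extract
  ; strip-extract = F.strip-front
  ; extract-embed = F.extract-embed
  ; embed-extract = F.embed-extract
  ; embed-solution   = λ H X → F.embed-minimal H X ∘ minimal-⇔ (F.transversal⇔hits H)
  ; extract-solution = λ H D → minimal-⇔ (λ X → mk⇔ (from (F.transversal⇔hits H X)) (to (F.transversal⇔hits H X))) ∘
      F.extract-minimal H D
  ; outputᵖ     = proj₁ bound
  ; output≤     = λ (G , _) X → ≤-trans (size-encodeSubset X)
      (≤-trans (+-monoʳ-≤ 1 (*-monoʳ-≤ 4 (length≤size-encodeList encodeSubset (tabulate (λ u → tabulate (Graph.adj G u))))))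
        (proj₂ bound (size (encodeGraph G))))
  }
  where
  module F = FromHypergraph
  bound : PolyBounded (λ n → 1 + 4 * n)
  bound = constᵇ 1 +ᵇ constᵇ 4 *ᵇ idᵇ

theorem8 : (HasOutputPolynomialAlgorithm (MinimalConnectedDominatingSets TwoDegenerateBipartite) →
    HasOutputPolynomialAlgorithm MinimalTransversals)
    × (HasPolynomialDelayAlgorithm (MinimalConnectedDominatingSets TwoDegenerateBipartite) →
    HasPolynomialDelayAlgorithm MinimalTransversals)
theorem8 = outputPolynomial reduction , polynomialDelay reduction
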